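{- Let $L\ge 1$ be an integer, and for $i\in\{1,2,3,4\}$ let $R_i(L)$ be the set of $R_i$ paths of length $2L$ with weights $W^{(i)}(p)$ as defined in the context. Let $Z_L = W(DE)^L V$ be the normalisation of the two-parameter asymmetric simple exclusion process (also defined in the context). Then $$Z_L=\sum_{p\in R_1(L)} W^{(1)}(p),\qquad Z_L=\sum_{p\in R_2(L)} W^{(2)}(p),$$ $$Z_L=\sum_{p\in R_3(L)} W^{(3)}(p),\qquad Z_L=\sum_{p\in R_4(L)} W^{(4)}(p).$$ The sum over $R_2(L)$ is infinite and the identity is understood in the ring $\mathbb{Q}[[c,d]]$ of formal power series in $c,d$; the other three sums are finite.
   Context: **Parameters.** Let $c,d$ be indeterminates and work in $K=\mathbb{Q}[[c,d]]$. Put $\bar\alpha=1+c$, $\bar\beta=1+d$ (in the exclusion process with entry probability $\alpha$ and exit probability $\beta$, $\bar\alpha=1/\alpha$ and $\bar\beta=1/\beta$), and let $\kappa\in K$ be the square root with constant term $1$ of $\kappa^2=1-cd=\bar\alpha+\bar\beta-\bar\alpha\bar\beta$. **Normalisation $Z_L$.** Matrices $D,E$, a row vector $W$ and a column vector $V$ satisfy the DEHP algebra if $DE=D+E$, $WE=\bar\alpha W$, $DV=\bar\beta V$; they are normalised by $WV=1$. Then $Z_L=W(DE)^LV=W(D+E)^LV$; its value depends only on these relations. Equivalently: let $A$ be the unital associative $K$-algebra generated by $D,E$ with the single relation $DE=D+E$, and let $\varphi:A\to K$ be the $K$-linear functional (corresponding to $X\mapsto WXV$) determined by $\varphi(1)=1$,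 $\varphi(EX)=\bar\alpha\,\varphi(X)$ and $\varphi(XD)=\bar\beta\,\varphi(X)$ for all $X\in A$; then $Z_L=\varphi((DE)^L)$. **Lattice paths.** All paths are sequences of vertices $v_0v_1\cdots v_{2L}$ in $\mathbb{Z}\times\mathbb{N}_0$ (with $\mathbb{N}_0=\{0,1,2,\dots\}$); the $i$-th step is $e_i=(v_{i-1},v_i)$, $1\le i\le 2L$, and $v_i-v_{i-1}$ must lie in the $i$-th step set. The height of $(x,y)$ is $y$. The weight $W^{(i)}(p)$ of a path is the product of the weight of its initial vertex, the weight of its final vertex, and the weights of all its steps. * **$R_1$ paths.** Step sets: $\{(1,-1)\}$ for $i$ even; $\{(1,2k-1): k\in\mathbb{N}_0\}$ for $i$ odd. $v_0=(0,2k+1)$ for some $k\in\mathbb{N}_0$, $v_{2L}=(2L,1)$. Weights: $v_0=(0,2k+1)$ has weight $\bar\alpha^k$; $v_{2L}$ has weight $1$; a step $e_i$ with $i$ odd from $(i-1,1)$ to $(i,2k'+2)$, $k'\in\mathbb{N}_0$, has weight $\bar\beta$; all other steps have weight $1$. * **$R_2$ paths.** Step sets $\{(1,-1),(1,1)\}$ for all $i$. $v_0=(0,2k+1)$ and $v_{2L}=(2L,2k'+1)$ for some $k,k'\in\mathbb{N}_0$. Weights: $v_0$ has weight $\kappa c^k$, $v_{2L}$ has weight $\kappa d^{k'}$, all steps have weight $1$. * **$R_3$ paths.** Step sets $\{(1,-1),(1,1)\}$ for all $i$. $v_0=(0,1)$, $v_{2L}=(2L,1)$, both of weight $1$. Step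 weights: $\kappa$ for a step from height $1$ to height $2$ or from height $2$ to height $1$; $\bar\beta$ for a step from height $1$ to height $0$; $\bar\alpha$ for a step from height $0$ to height $1$; $1$ otherwise. * **$R_4$ paths.** Step sets $\{(1,-1),(1,1)\}$ for all $i$. $v_0=(0,1)$, $v_{2L}=(2L,1)$, all vertices have height greater than zero, and exactly one of the height-one vertices is marked (so an $R_4$ path is a pair consisting of a path and a choice of one of its height-one vertices, where $v_0$ and $v_{2L}$ are allowed choices). The initial and final vertices have weight $1$. If the marked vertex is $v_k$, the step $e_i$ has weight $\bar\alpha$ if it goes from height $2$ to height $1$ and $i\le k$; weight $\bar\beta$ if it goes from height $1$ to height $2$ and $i>k$; weight $1$ otherwise. -}

module Defs where

open import Level using (0ℓ)
open import Algebra.Bundles using (CommutativeRing; Ring; Semiring)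
open import Algebra.Structures using (IsCommutativeRing; IsRing)
open import Data.Nat as ℕ using (ℕ; zero; suc; _∸_; ⌊_/2⌋; parity)
open import Data.Parity.Base using (Parity; 0ℙ; 1ℙ)
import Data.Parity.Properties as ℙ
open import Data.Integer as ℤ using (ℤ; +_; 0ℤ; 1ℤ; -1ℤ)
open import Data.Rational using (ℚ; 0ℚ; 1ℚ)
import Data.Rational as ℚ
import Data.Rational.Properties as ℚ
open import Data.Bool using (if_then_else_)
open import Data.Fin using (Fin; toℕ; inject₁) renaming (suc to fsuc)
open import Data.Vec using (Vec; head; last; lookup)
open import Data.List using (List; map; foldr)
open import Data.List.Membership.Propositional using (_∈_; _∉_)
open import Data.List.Relation.Unary.Unique.Propositional using (Unique)
open import Data.Product using (_×_; _,_; proj₂; ∃-syntax)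
open import Function.Bundles using (_⇔_)
open import Relation.Binary.PropositionalEquality using (_≡_)
open import Relation.Nullary using (does)
import Algebra.Definitions.RawSemiring as RawSemiring
import Relation.Binary.Reasoning.Setoid as SetoidReasoning

module PowerSeries {a ℓ} (R : CommutativeRing a ℓ) where

  open CommutativeRing R
  open RawSemiring (Semiring.rawSemiring semiring) using (sum)
  open SetoidReasoning setoid

  Series : Set a
  Series = ℕ → Carrier

  infix  4 _≈ₛ_
  infixl 6 _+ₛ_
  infixl 7 _*ₛ_

  _≈ₛ_ : Series → Series → Set ℓ
  f ≈ₛ g = ∀ n → f n ≈ g n

  _+ₛ_ _*ₛ_ : Series → Series → Series
  (f +ₛ g) n = f n + g n
  (f *ₛ g) n = sum {suc n} λ i → f (toℕ i) * g (n ∸ toℕ i)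

  -ₛ_ : Series → Series
  (-ₛ f) n = - f n

  const : Carrier → Series
  const r zero    = r
  const r (suc _) = 0#

  X : Series
  X zero          = 0#
  X (suc zero)    = 1#
  X (suc (suc _)) = 0#

  shift : Series → Series
  shift f n = f (suc n)

  +-interchange : ∀ w x y z → (w + x) + (y + z) ≈ (w + y) + (x + z)
  +-interchange w x y z = begin
    (w + x) + (y + z)  ≈⟨ +-assoc w x (y + z) ⟩
    w + (x + (y + z))  ≈⟨ +-congˡ (+-assoc x y z) ⟨
    w + ((x + y) + z)  ≈⟨ +-congˡ (+-congʳ (+-comm x y)) ⟩
    w + ((y + x) + z)  ≈⟨ +-congˡ (+-assoc y x z) ⟩
    w + (y + (x + z))  ≈⟨ +-assoc w y (x + z) ⟨
    (w + y) + (x + z)  ∎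

  *-congₛ : ∀ {f f′ g g′} → f ≈ₛ f′ → g ≈ₛ g′ → f *ₛ g ≈ₛ f′ *ₛ g′
  *-congₛ p q zero    = +-congʳ (*-cong (p 0) (q 0))
  *-congₛ p q (suc n) =
    +-cong (*-cong (p 0) (q (suc n))) (*-congₛ (λ m → p (suc m)) q n)

  *-distribʳₛ : ∀ h f g → (f +ₛ g) *ₛ h ≈ₛ f *ₛ h +ₛ g *ₛ h
  *-distribʳₛ h f g zero = begin
    (f 0 + g 0) * h 0 + 0#                  ≈⟨ +-identityʳ _ ⟩
    (f 0 + g 0) * h 0                       ≈⟨ distribʳ _ _ _ ⟩
    f 0 * h 0 + g 0 * h 0                   ≈⟨ +-cong (+-identityʳ _) (+-identityʳ _) ⟨
    (f 0 * h 0 + 0#) + (g 0 * h 0 + 0#)     ∎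
  *-distribʳₛ h f g (suc n) = begin
    (f 0 + g 0) * h (suc n) + (shift (f +ₛ g) *ₛ h) n
      ≈⟨ +-cong (distribʳ _ _ _) (*-distribʳₛ h (shift f) (shift g) n) ⟩
    (f 0 * h (suc n) + g 0 * h (suc n)) + ((shift f *ₛ h) n + (shift g *ₛ h) n)
      ≈⟨ +-interchange _ _ _ _ ⟩
    (f *ₛ h +ₛ g *ₛ h) (suc n) ∎

  scaleₛ : ∀ r f g n → ((λ m → r * f m) *ₛ g) n ≈ r * (f *ₛ g) n
  scaleₛ r f g zero = begin
    (r * f 0) * g 0 + 0#     ≈⟨ +-identityʳ _ ⟩
    (r * f 0) * g 0          ≈⟨ *-assoc _ _ _ ⟩
    r * (f 0 * g 0)          ≈⟨ *-congˡ (+-identityʳ _) ⟨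
    r * (f 0 * g 0 + 0#)     ∎
  scaleₛ r f g (suc n) = begin
    (r * f 0) * g (suc n) + ((λ m → r * f (suc m)) *ₛ g) n
      ≈⟨ +-cong (*-assoc _ _ _) (scaleₛ r (shift f) g n) ⟩
    r * (f 0 * g (suc n)) + r * (shift f *ₛ g) n
      ≈⟨ distribˡ _ _ _ ⟨
    r * (f *ₛ g) (suc n) ∎

  *-sucʳ : ∀ f g n → (f *ₛ g) (suc n) ≈ (f *ₛ shift g) n + f (suc n) * g 0
  *-sucʳ f g zero = begin
    f 0 * g 1 + (f 1 * g 0 + 0#)   ≈⟨ +-congˡ (+-identityʳ _) ⟩
    f 0 * g 1 + f 1 * g 0          ≈⟨ +-congʳ (+-identityʳ _) ⟨
    (f 0 * g 1 + 0#) + f 1 * g 0   ∎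
  *-sucʳ f g (suc n) = begin
    f 0 * g (2 ℕ.+ n) + (shift f *ₛ g) (suc n)
      ≈⟨ +-congˡ (*-sucʳ (shift f) g n) ⟩
    f 0 * g (2 ℕ.+ n) + ((shift f *ₛ shift g) n + f (2 ℕ.+ n) * g 0)
      ≈⟨ +-assoc _ _ _ ⟨
    (f *ₛ shift g) (suc n) + f (2 ℕ.+ n) * g 0 ∎

  *-commₛ : ∀ f g → f *ₛ g ≈ₛ g *ₛ f
  *-commₛ f g zero    = +-congʳ (*-comm _ _)
  *-commₛ f g (suc n) = begin
    f 0 * g (suc n) + (shift f *ₛ g) n   ≈⟨ +-cong (*-comm _ _) (*-commₛ (shift f) g n) ⟩
    g (suc n) * f 0 + (g *ₛ shift f) n   ≈⟨ +-comm _ _ ⟩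
    (g *ₛ shift f) n + g (suc n) * f 0   ≈⟨ *-sucʳ g f n ⟨
    (g *ₛ f) (suc n)                     ∎

  *-assocₛ : ∀ f g h → (f *ₛ g) *ₛ h ≈ₛ f *ₛ (g *ₛ h)
  *-assocₛ f g h zero = +-congʳ (begin
    (f 0 * g 0 + 0#) * h 0   ≈⟨ *-congʳ (+-identityʳ _) ⟩
    (f 0 * g 0) * h 0        ≈⟨ *-assoc _ _ _ ⟩
    f 0 * (g 0 * h 0)        ≈⟨ *-congˡ (+-identityʳ _) ⟨
    f 0 * (g 0 * h 0 + 0#)   ∎)
  *-assocₛ f g h (suc n) = begin
    (f 0 * g 0 + 0#) * h (suc n) + (((λ m → f 0 * g (suc m)) +ₛ shift f *ₛ g) *ₛ h) n
      ≈⟨ +-cong (*-congʳ (+-identityʳ _)) (*-distribʳₛ h (λ m → f 0 * g (suc m)) (shift f *ₛ g) n) ⟩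
    (f 0 * g 0) * h (suc n)
      + (((λ m → f 0 * g (suc m)) *ₛ h) n + ((shift f *ₛ g) *ₛ h) n)
      ≈⟨ +-cong (*-assoc _ _ _)
           (+-cong (scaleₛ (f 0) (shift g) h n) (*-assocₛ (shift f) g h n)) ⟩
    f 0 * (g 0 * h (suc n)) + (f 0 * (shift g *ₛ h) n + (shift f *ₛ (g *ₛ h)) n)
      ≈⟨ +-assoc _ _ _ ⟨
    (f 0 * (g 0 * h (suc n)) + f 0 * (shift g *ₛ h) n) + (shift f *ₛ (g *ₛ h)) n
      ≈⟨ +-congʳ (distribˡ _ _ _) ⟨
    (f *ₛ (g *ₛ h)) (suc n) ∎

  zero-*ₛ : ∀ f n → ((λ _ → 0#) *ₛ f) n ≈ 0#
  zero-*ₛ f zero    = trans (+-identityʳ _) (zeroˡ _)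
  zero-*ₛ f (suc n) = trans (+-cong (zeroˡ _) (zero-*ₛ f n)) (+-identityʳ _)

  *-identityˡₛ : ∀ f → const 1# *ₛ f ≈ₛ f
  *-identityˡₛ f zero    = trans (+-identityʳ _) (*-identityˡ _)
  *-identityˡₛ f (suc n) =
    trans (+-cong (*-identityˡ _) (zero-*ₛ f n)) (+-identityʳ _)

  const-0 : ∀ n → const 0# n ≈ 0#
  const-0 zero    = refl
  const-0 (suc _) = refl

  isCommutativeRingₛ : IsCommutativeRing _≈ₛ_ _+ₛ_ _*ₛ_ -ₛ_ (const 0#) (const 1#)
  isCommutativeRingₛ = record
    { isRing = record
      { +-isAbelianGroup = record
        { isGroup = record
          { isMonoid = record
            { isSemigroup = record
              { isMagma = record
                { isEquivalence = record
                  { refl  = λ _ → refl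
                  ; sym   = λ p n → sym (p n)
                  ; trans = λ p q n → trans (p n) (q n)
                  }
                ; ∙-cong = λ p q n → +-cong (p n) (q n)
                }
              ; assoc = λ f g h n → +-assoc (f n) (g n) (h n)
              }
            ; identity = (λ f n → trans (+-congʳ (const-0 n)) (+-identityˡ (f n)))
                       , (λ f n → trans (+-congˡ (const-0 n)) (+-identityʳ (f n)))
            }
          ; inverse = (λ f n → trans (-‿inverseˡ (f n)) (sym (const-0 n)))
                    , (λ f n → trans (-‿inverseʳ (f n)) (sym (const-0 n)))
          ; ⁻¹-cong = λ p n → -‿cong (p n)
          }
        ; comm = λ f g n → +-comm (f n) (g n)
        }
      ; *-cong     = *-congₛ
      ; *-assoc    = *-assocₛ
      ; *-identity = *-identityˡₛ
                   , (λ f n → trans (*-commₛ f (const 1#) n) (*-identityˡₛ f n))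
      ; distrib    = (λ h f g n → trans (*-commₛ h (f +ₛ g) n)
                       (trans (*-distribʳₛ h f g n)
                         (+-cong (*-commₛ f h n) (*-commₛ g h n))))
                   , *-distribʳₛ
      }
    ; *-comm = *-commₛ
    }

  commutativeRing : CommutativeRing a ℓ
  commutativeRing = record { isCommutativeRing = isCommutativeRingₛ }

-- K = ℚ[[d]][[c]]; the coefficient of cⁱ dʲ in f is f i j.

module ℚ[[d]]    = PowerSeries ℚ.+-*-commutativeRing
module ℚ[[d]][[c]] = PowerSeries ℚ[[d]].commutativeRing

𝕂 : CommutativeRing 0ℓ 0ℓ
𝕂 = ℚ[[d]][[c]].commutativeRing

module 𝕂 = CommutativeRing 𝕂
open 𝕂 using () renaming (Carrier to K)
open RawSemiring (Semiring.rawSemiring 𝕂.semiring) using (product) renaming (_^_ to _^ᴷ_)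

c d ᾱ β̄ : K
c = ℚ[[d]][[c]].X
d = ℚ[[d]][[c]].const ℚ[[d]].X
ᾱ = 𝕂.1# 𝕂.+ c
β̄ = 𝕂.1# 𝕂.+ d

coeff : ℕ → ℕ → K → ℚ
coeff i j f = f i j

record IsKappa (κ : K) : Set where
  field
    square       : κ 𝕂.* κ 𝕂.≈ 𝕂.1# 𝕂.- c 𝕂.* d
    constantTerm : coeff 0 0 κ ≡ 1ℚ

-- The unital associative K-algebra generated by D, E with DE = D + E
-- is Expr modulo _≋_; K is embedded by ι.

infixl 6 _⊕_
infixl 7 _⊗_
infix  8 ⊖_
infix  4 _≋_

data Expr : Set where
  ι       : K → Expr
  D E     : Expr
  _⊕_ _⊗_ : Expr → Expr → Expr
  ⊖_      : Expr → Expr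

data _≋_ : Expr → Expr → Set where
  ≋-refl  : ∀ {x} → x ≋ x
  ≋-sym   : ∀ {x y} → x ≋ y → y ≋ x
  ≋-trans : ∀ {x y z} → x ≋ y → y ≋ z → x ≋ z
  ι-cong  : ∀ {r s} → r 𝕂.≈ s → ι r ≋ ι s
  ⊕-cong  : ∀ {x x′ y y′} → x ≋ x′ → y ≋ y′ → x ⊕ y ≋ x′ ⊕ y′
  ⊗-cong  : ∀ {x x′ y y′} → x ≋ x′ → y ≋ y′ → x ⊗ y ≋ x′ ⊗ y′
  ⊖-cong  : ∀ {x x′} → x ≋ x′ → ⊖ x ≋ ⊖ x′

  ⊕-assoc     : ∀ x y z → (x ⊕ y) ⊕ z ≋ x ⊕ (y ⊕ z)
  ⊕-comm      : ∀ x y → x ⊕ y ≋ y ⊕ x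
  ⊕-identityˡ : ∀ x → ι 𝕂.0# ⊕ x ≋ x
  ⊖-inverseˡ  : ∀ x → ⊖ x ⊕ x ≋ ι 𝕂.0#
  ⊗-assoc     : ∀ x y z → (x ⊗ y) ⊗ z ≋ x ⊗ (y ⊗ z)
  ⊗-identityˡ : ∀ x → ι 𝕂.1# ⊗ x ≋ x
  ⊗-distribˡ  : ∀ x y z → x ⊗ (y ⊕ z) ≋ x ⊗ y ⊕ x ⊗ z
  ⊗-distribʳ  : ∀ x y z → (y ⊕ z) ⊗ x ≋ y ⊗ x ⊕ z ⊗ x

  ι-+       : ∀ r s → ι (r 𝕂.+ s) ≋ ι r ⊕ ι s
  ι-*       : ∀ r s → ι (r 𝕂.* s) ≋ ι r ⊗ ι s
  ι-central : ∀ r x → ι r ⊗ x ≋ x ⊗ ι r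

  DE≋D+E : D ⊗ E ≋ D ⊕ E

𝔸-isRing : IsRing _≋_ _⊕_ _⊗_ ⊖_ (ι 𝕂.0#) (ι 𝕂.1#)
𝔸-isRing = record
  { +-isAbelianGroup = record
    { isGroup = record
      { isMonoid = record
        { isSemigroup = record
          { isMagma = record
            { isEquivalence = record { refl = ≋-refl ; sym = ≋-sym ; trans = ≋-trans }
            ; ∙-cong = ⊕-cong
            }
          ; assoc = ⊕-assoc
          }
        ; identity = ⊕-identityˡ
                   , (λ x → ≋-trans (⊕-comm x (ι 𝕂.0#)) (⊕-identityˡ x))
        }
      ; inverse = ⊖-inverseˡ
                , (λ x → ≋-trans (⊕-comm x (⊖ x)) (⊖-inverseˡ x))
      ; ⁻¹-cong = ⊖-cong
      }
    ; comm = ⊕-comm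
    }
  ; *-cong     = ⊗-cong
  ; *-assoc    = ⊗-assoc
  ; *-identity = ⊗-identityˡ
               , (λ x → ≋-trans (≋-sym (ι-central 𝕂.1# x)) (⊗-identityˡ x))
  ; distrib    = ⊗-distribˡ , ⊗-distribʳ
  }

𝔸 : Ring 0ℓ 0ℓ
𝔸 = record { isRing = 𝔸-isRing }

open RawSemiring (Semiring.rawSemiring (Ring.semiring 𝔸)) using () renaming (_^_ to _^ᴬ_)

-- φ X is the scalar W X V of a normalised representation.
record DEHPFunctional : Set where
  field
    φ      : Expr → K
    φ-cong : ∀ {x y} → x ≋ y → φ x 𝕂.≈ φ y
    φ-+    : ∀ x y → φ (x ⊕ y) 𝕂.≈ φ x 𝕂.+ φ y
    φ-*    : ∀ r x → φ (ι r ⊗ x) 𝕂.≈ r 𝕂.* φ x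
    φ-1    : φ (ι 𝕂.1#) 𝕂.≈ 𝕂.1#
    φ-E    : ∀ x → φ (E ⊗ x) 𝕂.≈ ᾱ 𝕂.* φ x
    φ-D    : ∀ x → φ (x ⊗ D) 𝕂.≈ β̄ 𝕂.* φ x

normalisation : DEHPFunctional → ℕ → K
normalisation Φ L = DEHPFunctional.φ Φ ((D ⊗ E) ^ᴬ L)

module _ {A : Set} (P : A → Set) (w : A → K) (s : K) where

  FiniteSum : Set
  FiniteSum = ∃[ xs ] Unique xs
                    × (∀ x → x ∈ xs ⇔ P x)
                    × foldr 𝕂._+_ 𝕂.0# (map w xs) 𝕂.≈ s

  -- Each monomial occurs in only finitely many summands, and
  -- coefficientwise these add up to s.
  FormalSum : Set
  FormalSum = ∀ i j → ∃[ xs ] Unique xs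
                            × (∀ x → x ∈ xs → P x)
                            × (∀ x → P x → x ∉ xs → coeff i j (w x) ≡ 0ℚ)
                            × foldr ℚ._+_ 0ℚ (map (λ x → coeff i j (w x)) xs) ≡ coeff i j s

Vertex : Set
Vertex = ℤ × ℕ

height : Vertex → ℕ
height = proj₂

displacement : Vertex → Vertex → ℤ × ℤ
displacement (x , y) (x′ , y′) = x′ ℤ.- x , + y′ ℤ.- + y

-- A path v₀ v₁ ⋯ v_{2L}, as the vector of its vertices.
Path : ℕ → Set
Path L = Vec Vertex (suc (2 ℕ.* L))

-- The first argument of StepSet and stepWeight is the step number i,
-- with 1 ≤ i ≤ 2L.
record Family : Set₁ where
  field
    Initial       : Vertex → Set
    Final         : ℕ → Vertex → Set
    StepSet       : ℕ → ℤ × ℤ → Set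
    initialWeight : Vertex → K
    finalWeight   : Vertex → K
    stepWeight    : ℕ → Vertex → Vertex → K

module _ (F : Family) (L : ℕ) where
  open Family F

  -- j : Fin (2L) stands for the step e_{j+1} = (v_j , v_{j+1}).
  IsPath : Path L → Set
  IsPath p = Initial (head p)
           × Final L (last p)
           × (∀ (j : Fin (2 ℕ.* L)) →
                StepSet (suc (toℕ j))
                        (displacement (lookup p (inject₁ j)) (lookup p (fsuc j))))

  weight : Path L → K
  weight p = initialWeight (head p) 𝕂.* finalWeight (last p) 𝕂.*
             product {2 ℕ.* L} λ j →
               stepWeight (suc (toℕ j)) (lookup p (inject₁ j)) (lookup p (fsuc j))

data UpDown : ℤ × ℤ → Set where
  up   : UpDown (1ℤ , 1ℤ)
  down : UpDown (1ℤ , -1ℤ)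

-- In R₁ and R₂, the k of an initial or final height 2k+1 is ⌊ 2k+1 /2⌋.

R₁-Step : Parity → ℤ × ℤ → Set
R₁-Step 0ℙ δ = δ ≡ (1ℤ , -1ℤ)
R₁-Step 1ℙ δ = ∃[ k ] δ ≡ (1ℤ , + (2 ℕ.* k) ℤ.- 1ℤ)

-- suc (suc n) with n even is a height 2k′+2.
R₁-stepWeight : Parity → ℕ → ℕ → K
R₁-stepWeight 1ℙ 1 (suc (suc n)) = if does (parity n ℙ.≟ 0ℙ) then β̄ else 𝕂.1#
R₁-stepWeight _  _ _             = 𝕂.1#

R₁ : Family
R₁ = record
  { Initial       = λ v → ∃[ k ] v ≡ (0ℤ , 2 ℕ.* k ℕ.+ 1)
  ; Final         = λ L v → v ≡ (+ (2 ℕ.* L) , 1)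
  ; StepSet       = λ i → R₁-Step (parity i)
  ; initialWeight = λ v → ᾱ ^ᴷ ⌊ height v /2⌋
  ; finalWeight   = λ _ → 𝕂.1#
  ; stepWeight    = λ i u v → R₁-stepWeight (parity i) (height u) (height v)
  }

R₂ : K → Family
R₂ κ = record
  { Initial       = λ v → ∃[ k ] v ≡ (0ℤ , 2 ℕ.* k ℕ.+ 1)
  ; Final         = λ L v → ∃[ k′ ] v ≡ (+ (2 ℕ.* L) , 2 ℕ.* k′ ℕ.+ 1)
  ; StepSet       = λ _ → UpDown
  ; initialWeight = λ v → κ 𝕂.* c ^ᴷ ⌊ height v /2⌋
  ; finalWeight   = λ v → κ 𝕂.* d ^ᴷ ⌊ height v /2⌋
  ; stepWeight    = λ _ _ _ → 𝕂.1#
  }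

module _ (κ : K) where
  R₃-stepWeight : ℕ → ℕ → K
  R₃-stepWeight 1 2 = κ
  R₃-stepWeight 2 1 = κ
  R₃-stepWeight 1 0 = β̄
  R₃-stepWeight 0 1 = ᾱ
  R₃-stepWeight _ _ = 𝕂.1#

  R₃ : Family
  R₃ = record
    { Initial       = λ v → v ≡ (0ℤ , 1)
    ; Final         = λ L v → v ≡ (+ (2 ℕ.* L) , 1)
    ; StepSet       = λ _ → UpDown
    ; initialWeight = λ _ → 𝕂.1#
    ; finalWeight   = λ _ → 𝕂.1#
    ; stepWeight    = λ _ u v → R₃-stepWeight (height u) (height v)
    }

-- R₄ paths are pairs (p , m) whose marked vertex is the m-th vertex of p.

module _ (m : ℕ) where
  R₄-stepWeight : ℕ → ℕ → ℕ → K
  R₄-stepWeight i 2 1 = if does (i ℕ.≤? m) then ᾱ else 𝕂.1#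
  R₄-stepWeight i 1 2 = if does (m ℕ.<? i) then β̄ else 𝕂.1#
  R₄-stepWeight _ _ _ = 𝕂.1#

  R₄-marked : Family
  R₄-marked = record
    { Initial       = λ v → v ≡ (0ℤ , 1)
    ; Final         = λ L v → v ≡ (+ (2 ℕ.* L) , 1)
    ; StepSet       = λ _ → UpDown
    ; initialWeight = λ _ → 𝕂.1#
    ; finalWeight   = λ _ → 𝕂.1#
    ; stepWeight    = λ i u v → R₄-stepWeight i (height u) (height v)
    }

MarkedPath : ℕ → Set
MarkedPath L = Path L × Fin (suc (2 ℕ.* L))

IsR₄Path : ∀ L → MarkedPath L → Set
IsR₄Path L (p , m) = IsPath (R₄-marked (toℕ m)) L p
                   × (∀ j → 0 ℕ.< height (lookup p j))
                   × height (lookup p m) ≡ 1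

R₄-weight : ∀ L → MarkedPath L → K
R₄-weight L (p , m) = weight (R₄-marked (toℕ m)) L p

{-# OPTIONS --safe #-}

-- All four sums are compared with q n 0, where q is the solution of a birth–death
-- recurrence whose generating function is q k = tᵏ / ((1 - α s)(1 - β s)),
-- z = s (1 - s), t = s / (1 - s). The numbers f n k = φ ((DE)ⁿ Eᵏ) satisfy
-- f (n+1) 0 = β f n 0 + f n 1 and f (n+1) (k+1) = f (n+1) k + f n (k+2), which
-- determines them and yields f n 0 = q n 0. Splitting a path of length 2 L into L double
-- steps between the odd heights 2 k + 1 turns each weighted count into a recurrence:
-- * for R₁ it is solved by the coefficients of (DE)ⁿ V in the vectors Eᵏ V;
-- * for R₃ it is solved by q n 0 and κ q n k, k ≥ 1;
-- * for R₄, summing over the position of the mark, it is solved by q n 0 and α q n k, k ≥ 1;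
-- * for R₂, with g n k the count of paths from height 2 k + 1 and κ² = 1 - c d, the sum
--   κ Σ_m cᵐ g n (k + m) satisfies the recurrence of φ ((D - 1)ᵏ (DE)ⁿ). Cutting it off at
--   m ≤ M changes it by a multiple of c^(M+1) only, so each coefficient is a finite sum.

module Submission where

open import Algebra.Bundles using (CommutativeRing; Semiring; Ring)
import Algebra.Definitions.RawSemiring as RawSemiring
import Algebra.Properties.CommutativeSemigroup as CommutativeSemigroupProperties
import Algebra.Solver.Ring.NaturalCoefficients.Default as RingSolver
open import Data.Empty using (⊥; ⊥-elim)
open import Data.Fin using (Fin; toℕ; inject₁) renaming (zero to fzero; suc to fsuc)
open import Data.Integer as ℤ using (ℤ; +_; 0ℤ; 1ℤ)
import Data.Integer.Properties as ℤ
open import Data.Integer.Tactic.RingSolver using (solve-∀)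
open import Data.List using (List; []; _∷_; _++_; foldr; map)
open import Data.List.Membership.Propositional using (_∈_)
open import Data.List.Membership.Propositional.Properties
  using (∈-map⁺; ∈-map⁻; ∈-++⁺ˡ; ∈-++⁺ʳ; ∈-++⁻)
import Data.List.Relation.Unary.All as All
import Data.List.Relation.Unary.AllPairs as AllPairs
open import Data.List.Relation.Unary.Any using (here; there)
open import Data.List.Relation.Unary.Unique.Propositional using (Unique)
open import Data.List.Relation.Unary.Unique.Propositional.Properties
  using (map⁺; ++⁺; Unique[x∷xs]⇒x∉xs)
open import Data.Nat as ℕ using (ℕ; zero; suc; ⌊_/2⌋; parity; _≤_; _<_; z≤n; s≤s)
import Data.Nat.Properties as ℕ
open import Data.Parity.Base using (0ℙ; 1ℙ)
open import Data.Product using (_×_; _,_; proj₁; proj₂; ∃-syntax)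
open import Data.Rational as ℚ using (0ℚ)
import Data.Rational.Properties as ℚ
open import Data.Sum using (_⊎_; inj₁; inj₂; [_,_]′)
open import Data.Vec using (Vec; []; _∷_; lookup; head; last)
open import Data.Vec.Properties using (∷-injectiveˡ; ∷-injectiveʳ)
open import Defs
open import Function using (_∘_; id)
open import Function.Bundles using (_⇔_; mk⇔; Equivalence)
open import Level using (_⊔_)
open import Relation.Binary.PropositionalEquality as ≡ using (_≡_; _≢_; cong)
import Relation.Binary.Reasoning.Setoid as SetoidReasoning
open import Relation.Nullary using (¬_; Dec; contradiction; yes; no)

-- Unlike 2 * n and 2 * k + 1, these unfold by double steps.
double : ℕ → ℕ
double zero    = 0
double (suc n) = 2 ℕ.+ double n

odd : ℕ → ℕ
odd zero    = 1
odd (suc k) = 2 ℕ.+ odd k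

-- range N k lists k, …, N - 1.
range : ℕ → ℕ → List ℕ
range zero    k       = []
range (suc N) zero    = 0 ∷ map suc (range N 0)
range (suc N) (suc k) = map suc (range N k)

neighbours : ℕ → List ℕ
neighbours zero    = 1 ∷ []
neighbours (suc h) = h ∷ 2 ℕ.+ h ∷ []

posNeighbours : ℕ → List ℕ
posNeighbours zero          = 1 ∷ []
posNeighbours (suc zero)    = 2 ∷ []
posNeighbours (suc (suc h)) = 1 ℕ.+ h ∷ 3 ℕ.+ h ∷ []

-- Finite sums and tail sums over a commutative ring.

module Sums {a ℓ} (R : CommutativeRing a ℓ) where
  open CommutativeRing R hiding (zero)
  open SetoidReasoning setoid
  open RingSolver commutativeSemiring

  ∑ : {A : Set} → List A → (A → Carrier) → Carrier
  ∑ xs f = foldr _+_ 0# (map f xs)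

  ∑-cong : ∀ {A : Set} (xs : List A) {f g} → (∀ x → f x ≈ g x) → ∑ xs f ≈ ∑ xs g
  ∑-cong []       f≈g = refl
  ∑-cong (x ∷ xs) f≈g = +-cong (f≈g x) (∑-cong xs f≈g)

  ∑-++ : ∀ {A : Set} (xs ys : List A) f → ∑ (xs ++ ys) f ≈ ∑ xs f + ∑ ys f
  ∑-++ []       ys f = sym (+-identityˡ _)
  ∑-++ (x ∷ xs) ys f = trans (+-congˡ (∑-++ xs ys f)) (sym (+-assoc _ _ _))

  ∑-map : ∀ {A B : Set} (g : A → B) xs f → ∑ (map g xs) f ≈ ∑ xs (f ∘ g)
  ∑-map g []       f = refl
  ∑-map g (x ∷ xs) f = +-congˡ (∑-map g xs f)

  ∑-*ˡ : ∀ {A : Set} r (xs : List A) f → ∑ xs (λ x → r * f x) ≈ r * ∑ xs f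
  ∑-*ˡ r []       f = sym (zeroʳ r)
  ∑-*ˡ r (x ∷ xs) f = trans (+-congˡ (∑-*ˡ r xs f)) (sym (distribˡ _ _ _))

  -- Σ[ k ≤ j < N ] f j
  tailSum : ℕ → (ℕ → Carrier) → ℕ → Carrier
  tailSum zero    f k       = 0#
  tailSum (suc N) f zero    = f 0 + tailSum N (f ∘ suc) 0
  tailSum (suc N) f (suc k) = tailSum N (f ∘ suc) k

  ∑-range : ∀ N k f → ∑ (range N k) f ≈ tailSum N f k
  ∑-range zero    k       f = refl
  ∑-range (suc N) zero    f =
    +-congˡ (trans (∑-map suc (range N 0) f) (∑-range N 0 (f ∘ suc)))
  ∑-range (suc N) (suc k) f = trans (∑-map suc (range N k) f) (∑-range N k (f ∘ suc))

  tailSum-cong : ∀ N {f g} → (∀ j → f j ≈ g j) → ∀ k → tailSum N f k ≈ tailSum N g k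
  tailSum-cong zero    f≈g k       = refl
  tailSum-cong (suc N) f≈g zero    = +-cong (f≈g 0) (tailSum-cong N (f≈g ∘ suc) 0)
  tailSum-cong (suc N) f≈g (suc k) = tailSum-cong N (f≈g ∘ suc) k

  tailSum-+ : ∀ N f g →
              tailSum N (λ j → f j + g j) 0 ≈ tailSum N f 0 + tailSum N g 0
  tailSum-+ zero    f g = sym (+-identityˡ 0#)
  tailSum-+ (suc N) f g = trans (+-congˡ (tailSum-+ N (f ∘ suc) (g ∘ suc)))
    (solve 4 (λ x y s t → (x :+ y) :+ (s :+ t) := (x :+ s) :+ (y :+ t)) refl
       (f 0) (g 0) _ _)

  tailSum-*ˡ : ∀ N r f → tailSum N (λ j → r * f j) 0 ≈ r * tailSum N f 0
  tailSum-*ˡ zero    r f = sym (zeroʳ r)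
  tailSum-*ˡ (suc N) r f = trans (+-congˡ (tailSum-*ˡ N r (f ∘ suc))) (sym (distribˡ _ _ _))

  tailSum-snoc : ∀ N f → tailSum (suc N) f 0 ≈ tailSum N f 0 + f N
  tailSum-snoc zero    f = +-comm _ _
  tailSum-snoc (suc N) f = trans (+-congˡ (tailSum-snoc N (f ∘ suc))) (sym (+-assoc _ _ _))

  -- Exchange of summation over i ≤ j. The summand `s` carries the induction: removing index 0 from
  -- both sums turns `s` into `s + b 0`.
  tailSum-swap : ∀ N a b s →
    tailSum N (λ j → a j * (s + tailSum (suc j) b 0)) 0
      ≈ s * tailSum N a 0 + tailSum N (λ k → b k * tailSum N a k) 0
  tailSum-swap zero    a b s = sym (trans (+-identityʳ _) (zeroʳ s))
  tailSum-swap (suc N) a b s = begin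
    a 0 * (s + (b 0 + 0#))
      + tailSum N (λ j → a (suc j) * (s + (b 0 + tailSum (suc j) (b ∘ suc) 0))) 0
      ≈⟨ +-congˡ (tailSum-cong N (λ j → *-congˡ (sym (+-assoc _ _ _))) 0) ⟩
    a 0 * (s + (b 0 + 0#))
      + tailSum N (λ j → a (suc j) * ((s + b 0) + tailSum (suc j) (b ∘ suc) 0)) 0
      ≈⟨ +-congˡ (tailSum-swap N (a ∘ suc) (b ∘ suc) (s + b 0)) ⟩
    a 0 * (s + (b 0 + 0#))
      + ((s + b 0) * tailSum N (a ∘ suc) 0
         + tailSum N (λ k → b (suc k) * tailSum N (a ∘ suc) k) 0)
      ≈⟨ solve 5 (λ x s y t u →
           x :* (s :+ (y :+ con 0)) :+ ((s :+ y) :* t :+ u)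
             := s :* (x :+ t) :+ (y :* (x :+ t) :+ u)) refl (a 0) s (b 0) _ _ ⟩
    s * (a 0 + tailSum N (a ∘ suc) 0)
      + (b 0 * (a 0 + tailSum N (a ∘ suc) 0)
         + tailSum N (λ k → b (suc k) * tailSum N (a ∘ suc) k) 0) ∎

-- Recurrences for the normalisation and for the weighted walks.

module Recurrences {a ℓ} (R : CommutativeRing a ℓ)
                   (c d : CommutativeRing.Carrier R) where
  open CommutativeRing R hiding (zero)
  open SetoidReasoning setoid
  open RingSolver commutativeSemiring
  open RawSemiring (Semiring.rawSemiring semiring) using (_^_)
  open Sums R

  -- `α` and `β` are ᾱ and β̄, and `μ` is α + β - α β = 1 - c d, the square of κ. Writing it with
  -- the atom `γ` = 1 - α keeps the identities within reach of a semiring solver.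
  α β γ μ : Carrier
  α = 1# + c
  β = 1# + d
  γ = - c
  μ = α + β * γ

  α+γ≈1 : α + γ ≈ 1#
  α+γ≈1 = trans (+-assoc _ _ _) (trans (+-congˡ (-‿inverseʳ c)) (+-identityʳ 1#))

  αβ+μ≈α+β : α * β + μ ≈ α + β
  αβ+μ≈α+β = begin
    α * β + (α + β * γ)
      ≈⟨ solve 3 (λ α β γ → α :* β :+ (α :+ β :* γ) := α :+ β :* (α :+ γ)) refl α β γ ⟩
    α + β * (α + γ) ≈⟨ +-congˡ (trans (*-congˡ α+γ≈1) (*-identityʳ β)) ⟩
    α + β ∎

  μ+cd≈1 : μ + c * d ≈ 1#
  μ+cd≈1 = begin
    (1# + c + (1# + d) * γ) + c * d
      ≈⟨ solve 3 (λ c d γ → (con 1 :+ c :+ (con 1 :+ d) :* γ) :+ c :* d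
                    := con 1 :+ (c :+ γ) :* (con 1 :+ d)) refl c d γ ⟩
    1# + (c + γ) * (1# + d)
      ≈⟨ +-congˡ (trans (*-congʳ (-‿inverseʳ c)) (zeroˡ _)) ⟩
    1# + 0# ≈⟨ +-identityʳ 1# ⟩
    1# ∎

  μ≈1-cd : μ ≈ 1# - c * d
  μ≈1-cd = begin
    μ                        ≈⟨ +-identityʳ μ ⟨
    μ + 0#                   ≈⟨ +-congˡ (-‿inverseʳ (c * d)) ⟨
    μ + (c * d - c * d)      ≈⟨ +-assoc _ _ _ ⟨
    (μ + c * d) - c * d      ≈⟨ +-congʳ μ+cd≈1 ⟩
    1# - c * d               ∎

  -- q n k is the coefficient of zⁿ in tᵏ / ((1 - α s)(1 - β s)),
  -- where t = s / (1 - s) and z = s (1 - s), so that t = z (1 + t)².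
  q : ℕ → ℕ → Carrier
  q zero    zero    = 1#
  q zero    (suc k) = 0#
  q (suc n) zero    = (α + β) * q n 0 + μ * q n 1
  q (suc n) (suc k) = q n k + (q n (1 ℕ.+ k) + q n (1 ℕ.+ k)) + q n (2 ℕ.+ k)

  -- Modulo the left ideal of D - β, the product D Eʲ⁺¹ is β + E + ⋯ + Eʲ⁺¹, so only the constant
  -- term carries β. On the side of R₁ this is the weight of an odd-numbered step from height 2 k +
  -- 1 to a positive height.
  w₁ : ℕ → Carrier
  w₁ zero    = β
  w₁ (suc _) = 1#

  -- ρ n k is the coefficient of Eᵏ in (DE)ⁿ modulo the left ideal of D - β.
  ρ : ℕ → ℕ → Carrier
  ρ zero    zero    = 1#
  ρ zero    (suc k) = 0#
  ρ (suc n) k       = w₁ k * tailSum (suc n) (ρ n) (ℕ.pred k)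

  -- The hypotheses hold for f n k = φ ((DE)ⁿ Eᵏ).
  module Powers
    (f : ℕ → ℕ → Carrier)
    (f-init : ∀ k → f 0 k ≈ α ^ k)
    (f-zero : ∀ n → f (suc n) 0 ≈ β * f n 0 + f n 1)
    (f-suc  : ∀ n k → f (suc n) (suc k) ≈ f (suc n) k + f n (2 ℕ.+ k))
    where

    private
      p : ℕ → ℕ → ℕ → Carrier
      p n zero    i = q n (suc i)
      p n (suc k) i = p n k i + p n k (suc i)

      p-init : ∀ k i → p 0 k i ≈ 0#
      p-init zero    i = refl
      p-init (suc k) i = trans (+-cong (p-init k i) (p-init k (suc i))) (+-identityˡ 0#)

      -- From t = z (1 + t)²: the series tⁱ⁺² (1 + t)ᵏ is z tⁱ⁺¹ (1 + t)ᵏ⁺², up to the common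
      -- denominator, and coefficients of zⁿ⁺¹ are compared.
      p-suc : ∀ n k i → p (suc n) k (suc i) ≈ p n (2 ℕ.+ k) i
      p-suc n zero    i = solve 3 (λ x y z → x :+ (y :+ y) :+ z := (x :+ y) :+ (y :+ z)) refl
                            (q n (1 ℕ.+ i)) (q n (2 ℕ.+ i)) (q n (3 ℕ.+ i))
      p-suc n (suc k) i = +-cong (p-suc n k i) (p-suc n k (suc i))

      -- p n k 0 is the coefficient of zⁿ in t (1 + t)ᵏ / ((1 - α s)(1 - β s)).
      F : ℕ → ℕ → Carrier
      F n zero    = q n 0
      F n (suc k) = α * F n k + μ * p n k 0

      -- The case k = 0 is where α β + μ = α + β enters. The inductive step is linear: α times the
      -- previous identity plus μ times `p-suc`.
      F-suc : ∀ n k → F (suc n) (suc k) ≈ F (suc n) k + F n (2 ℕ.+ k)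
      F-suc n zero = begin
        α * ((α + β) * x + μ * y) + μ * (x + (y + y) + z)
          ≈⟨ solve 6 (λ α β μ x y z →
               α :* ((α :+ β) :* x :+ μ :* y) :+ μ :* (x :+ (y :+ y) :+ z)
                 := (α :* β :+ μ) :* x :+ (α :* (α :* x :+ μ :* y) :+ μ :* (y :+ y :+ z)))
               refl α β μ x y z ⟩
        (α * β + μ) * x + (α * (α * x + μ * y) + μ * (y + y + z))
          ≈⟨ +-congʳ (*-congʳ αβ+μ≈α+β) ⟩
        (α + β) * x + (α * (α * x + μ * y) + μ * (y + y + z))
          ≈⟨ solve 6 (λ α β μ x y z →
               (α :+ β) :* x :+ (α :* (α :* x :+ μ :* y) :+ μ :* (y :+ y :+ z))
                 := ((α :+ β) :* x :+ μ :* y) :+ (α :* (α :* x :+ μ :* y) :+ μ :* (y :+ z)))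
               refl α β μ x y z ⟩
        ((α + β) * x + μ * y) + (α * (α * x + μ * y) + μ * (y + z)) ∎
        where
          x = q n 0
          y = q n 1
          z = q n 2
      F-suc n (suc k) = begin
        α * F (suc n) (suc k) + μ * (p (suc n) k 0 + p (suc n) k 1)
          ≈⟨ +-cong (*-congˡ (F-suc n k)) (*-congˡ (+-congˡ (p-suc n k 0))) ⟩
        α * (F (suc n) k + F n (2 ℕ.+ k)) + μ * (p (suc n) k 0 + p n (2 ℕ.+ k) 0)
          ≈⟨ solve 6 (λ α μ x y u v → α :* (x :+ y) :+ μ :* (u :+ v)
                        := (α :* x :+ μ :* u) :+ (α :* y :+ μ :* v))
               refl α μ _ _ _ _ ⟩
        F (suc n) (suc k) + F n (3 ℕ.+ k) ∎

      -- The hypotheses reach every value of `f` by induction on n and, for fixed n, on k. The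
      -- boundary rule of `q` is the one of `f`, since F n 1 = α q n 0 + μ q n 1.
      f≈F : ∀ n k → f n k ≈ F n k
      f≈F zero k = trans (f-init k) (α^≈F k)
        where
        α^≈F : ∀ k → α ^ k ≈ F 0 k
        α^≈F zero    = refl
        α^≈F (suc k) = begin
          α * α ^ k                   ≈⟨ *-congˡ (α^≈F k) ⟩
          α * F 0 k                   ≈⟨ +-identityʳ _ ⟨
          α * F 0 k + 0#              ≈⟨ +-congˡ (trans (*-congˡ (p-init k 0)) (zeroʳ μ)) ⟨
          α * F 0 k + μ * p 0 k 0     ∎
      f≈F (suc n) zero = begin
        f (suc n) 0            ≈⟨ f-zero n ⟩
        β * f n 0 + f n 1      ≈⟨ +-cong (*-congˡ (f≈F n 0)) (f≈F n 1) ⟩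
        β * q n 0 + (α * q n 0 + μ * q n 1)
          ≈⟨ solve 4 (λ α β x y → β :* x :+ (α :* x :+ y) := (α :+ β) :* x :+ y)
               refl α β (q n 0) (μ * q n 1) ⟩
        (α + β) * q n 0 + μ * q n 1 ∎
      f≈F (suc n) (suc k) = begin
        f (suc n) (suc k)           ≈⟨ f-suc n k ⟩
        f (suc n) k + f n (2 ℕ.+ k) ≈⟨ +-cong (f≈F (suc n) k) (f≈F n (2 ℕ.+ k)) ⟩
        F (suc n) k + F n (2 ℕ.+ k) ≈⟨ F-suc n k ⟨
        F (suc n) (suc k)           ∎

    f≈q : ∀ n → f n 0 ≈ q n 0
    f≈q n = f≈F n 0

    -- Iterating `f-suc` down to k = 0 mirrors D Eᵏ⁺¹ = D + E + ⋯ + Eᵏ⁺¹.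
    f-sum : ∀ n k → f (suc n) k ≈ β * f n 0 + tailSum (suc k) (f n ∘ suc) 0
    f-sum n zero    = trans (f-zero n) (+-congˡ (sym (+-identityʳ _)))
    f-sum n (suc k) = begin
      f (suc n) (suc k)                                            ≈⟨ f-suc n k ⟩
      f (suc n) k + f n (2 ℕ.+ k)                                  ≈⟨ +-congʳ (f-sum n k) ⟩
      (β * f n 0 + tailSum (suc k) (f n ∘ suc) 0) + f n (2 ℕ.+ k)  ≈⟨ +-assoc _ _ _ ⟩
      β * f n 0 + (tailSum (suc k) (f n ∘ suc) 0 + f n (2 ℕ.+ k))
        ≈⟨ +-congˡ (tailSum-snoc (suc k) (f n ∘ suc)) ⟨
      β * f n 0 + tailSum (2 ℕ.+ k) (f n ∘ suc) 0                  ∎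

    -- Read the left side as φ ((DE)ⁿ (DE)ᵐ) and expand the right factor in powers of E by `ρ m`.
    -- The induction moves one DE from one factor to the other, and `tailSum-swap` collects the
    -- coefficient of each power.
    f≈Σρf : ∀ m n → f (m ℕ.+ n) 0 ≈ tailSum (suc m) (λ k → ρ m k * f n k) 0
    f≈Σρf zero    n = sym (trans (+-identityʳ _) (*-identityˡ _))
    f≈Σρf (suc m) n = begin
      f (suc m ℕ.+ n) 0
        ≡⟨ cong (λ i → f i 0) (ℕ.+-suc m n) ⟨
      f (m ℕ.+ suc n) 0
        ≈⟨ f≈Σρf m (suc n) ⟩
      tailSum (suc m) (λ k → ρ m k * f (suc n) k) 0
        ≈⟨ tailSum-cong (suc m) (λ k → *-congˡ {ρ m k} (f-sum n k)) 0 ⟩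
      tailSum (suc m) (λ k → ρ m k * (β * f n 0 + tailSum (suc k) (f n ∘ suc) 0)) 0
        ≈⟨ tailSum-swap (suc m) (ρ m) (f n ∘ suc) (β * f n 0) ⟩
      β * f n 0 * t 0 + tailSum (suc m) (λ k → f n (suc k) * t k) 0
        -- The first term becomes the one for E⁰, where `w₁ 0` is β and `pred 0` is 0; in the others
        -- `w₁` is 1 and has to be inserted.
        ≈⟨ +-cong (solve 3 (λ x y z → x :* y :* z := x :* z :* y) refl β (f n 0) (t 0))
             (tailSum-cong (suc m) (λ k → trans (*-comm (f n (suc k)) (t k)) (*-congʳ (sym (*-identityˡ _)))) 0) ⟩
      tailSum (2 ℕ.+ m) (λ k → ρ (suc m) k * f n k) 0 ∎
      where t = tailSum (suc m) (ρ m)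

    -- With no DE left in front, Eᵏ evaluates to αᵏ, the initial weight of an R₁ path.
    f≈Σρ : ∀ n → f n 0 ≈ tailSum (suc n) (λ k → α ^ k * ρ n k) 0
    f≈Σρ n = begin
      f n 0                                    ≡⟨ cong (λ i → f i 0) (ℕ.+-identityʳ n) ⟨
      f (n ℕ.+ 0) 0                            ≈⟨ f≈Σρf n 0 ⟩
      tailSum (suc n) (λ k → ρ n k * f 0 k) 0
        ≈⟨ tailSum-cong (suc n) (λ k → trans (*-comm (ρ n k) _) (*-congʳ (f-init k))) 0 ⟩
      tailSum (suc n) (λ k → α ^ k * ρ n k) 0  ∎

  -- Weighted walk counts by recursion on the first step.

  walkSum : (ℕ → List ℕ) → (ℕ → ℕ → Carrier) → (ℕ → Carrier) → ℕ → ℕ → Carrier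
  walkSum cand w v zero    h = v h
  walkSum cand w v (suc n) h = ∑ (cand h) λ h′ → w h h′ * walkSum cand w v n h′

  walkSum-cong : ∀ cand {w w′} v → (∀ h h′ → w h h′ ≈ w′ h h′) →
                 ∀ n h → walkSum cand w v n h ≈ walkSum cand w′ v n h
  walkSum-cong cand v w≈w′ zero    h = refl
  walkSum-cong cand v w≈w′ (suc n) h =
    ∑-cong (cand h) (λ h′ → *-cong (w≈w′ h h′) (walkSum-cong cand v w≈w′ n h′))

  -- A double step with unit weights reaches the lower and the upper odd neighbour in one way each
  -- and returns in two. The left side has the shape into which `walkSum` unfolds.
  interior : ∀ x y z →
    1# * (1# * x + (1# * y + 0#)) + (1# * (1# * y + (1# * z + 0#)) + 0#) ≈ x + (y + y) + z
  interior = solve 3 (λ x y z →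
    con 1 :* (con 1 :* x :+ (con 1 :* y :+ con 0))
      :+ (con 1 :* (con 1 :* y :+ (con 1 :* z :+ con 0)) :+ con 0)
      := x :+ (y :+ y) :+ z) refl

  δ₁ : ℕ → Carrier
  δ₁ zero          = 0#
  δ₁ (suc zero)    = 1#
  δ₁ (suc (suc _)) = 0#

  -- Walks with the weights of R₃.

  module R₃-Sum (κ : Carrier) (κ²≈1-cd : κ * κ ≈ 1# - c * d) where

    private
      κ²≈μ : κ * κ ≈ μ
      κ²≈μ = trans κ²≈1-cd (sym μ≈1-cd)

    w₃ : ℕ → ℕ → Carrier
    w₃ 1 2 = κ
    w₃ 2 1 = κ
    w₃ 1 0 = β
    w₃ 0 1 = α
    w₃ _ _ = 1#

    σ₃ : ℕ → ℕ → Carrier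
    σ₃ = walkSum neighbours w₃ δ₁

    private
      κq : ℕ → ℕ → Carrier
      κq n zero    = q n 0
      κq n (suc k) = κ * q n (suc k)

      -- From height 1, returning through height 0 contributes α β and returning through height 2
      -- contributes κ² = μ, together α + β. Moving on to height 3 contributes κ, which with the
      -- factor κ of `κq` is again μ.
      σ₃≈κq : ∀ n k → σ₃ (double n) (odd k) ≈ κq n k
      σ₃≈κq zero    zero          = refl
      σ₃≈κq zero    (suc k)       = sym (zeroʳ κ)
      σ₃≈κq (suc n) zero          = begin
        β * (α * x + 0#) + (κ * (κ * x + (1# * y + 0#)) + 0#)
          ≈⟨ +-cong (*-congˡ (+-congʳ (*-congˡ (σ₃≈κq n 0))))
               (+-congʳ (*-congˡ (+-cong (*-congˡ (σ₃≈κq n 0))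
                                         (+-congʳ (*-congˡ (σ₃≈κq n 1)))))) ⟩
        β * (α * q n 0 + 0#) + (κ * (κ * q n 0 + (1# * (κ * q n 1) + 0#)) + 0#)
          ≈⟨ solve 5 (λ α β κ x y →
               β :* (α :* x :+ con 0)
                 :+ (κ :* (κ :* x :+ (con 1 :* (κ :* y) :+ con 0)) :+ con 0)
                 := (α :* β :+ κ :* κ) :* x :+ κ :* κ :* y) refl α β κ (q n 0) (q n 1) ⟩
        (α * β + κ * κ) * q n 0 + κ * κ * q n 1
          ≈⟨ +-cong (*-congʳ (trans (+-congˡ κ²≈μ) αβ+μ≈α+β)) (*-congʳ κ²≈μ) ⟩
        (α + β) * q n 0 + μ * q n 1 ∎
        where
          x = σ₃ (double n) 1
          y = σ₃ (double n) 3
      σ₃≈κq (suc n) (suc zero)    = begin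
        1# * (κ * x + (1# * y + 0#)) + (1# * (1# * y + (1# * z + 0#)) + 0#)
          ≈⟨ +-cong (*-congˡ (+-cong (*-congˡ (σ₃≈κq n 0)) (+-congʳ (*-congˡ (σ₃≈κq n 1)))))
               (+-congʳ (*-congˡ (+-cong (*-congˡ (σ₃≈κq n 1))
                                         (+-congʳ (*-congˡ (σ₃≈κq n 2)))))) ⟩
        1# * (κ * q n 0 + (1# * (κ * q n 1) + 0#))
          + (1# * (1# * (κ * q n 1) + (1# * (κ * q n 2) + 0#)) + 0#)
          ≈⟨ solve 4 (λ κ x y z →
               con 1 :* (κ :* x :+ (con 1 :* (κ :* y) :+ con 0))
                 :+ (con 1 :* (con 1 :* (κ :* y) :+ (con 1 :* (κ :* z) :+ con 0)) :+ con 0)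
                 := κ :* (x :+ (y :+ y) :+ z)) refl κ (q n 0) (q n 1) (q n 2) ⟩
        κ * q (suc n) 1 ∎
        where
          x = σ₃ (double n) 1
          y = σ₃ (double n) 3
          z = σ₃ (double n) 5
      σ₃≈κq (suc n) (suc (suc k)) = begin
        σ₃ (double (suc n)) (odd (2 ℕ.+ k))
          ≈⟨ interior (σ₃ (double n) (odd (1 ℕ.+ k))) (σ₃ (double n) (odd (2 ℕ.+ k)))
               (σ₃ (double n) (odd (3 ℕ.+ k))) ⟩
        _ ≈⟨ +-cong (+-cong (σ₃≈κq n (1 ℕ.+ k))
                            (+-cong (σ₃≈κq n (2 ℕ.+ k)) (σ₃≈κq n (2 ℕ.+ k))))
               (σ₃≈κq n (3 ℕ.+ k)) ⟩
        _ ≈⟨ solve 4 (λ κ x y z → κ :* x :+ (κ :* y :+ κ :* y) :+ κ :* z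
                        := κ :* (x :+ (y :+ y) :+ z)) refl κ _ _ _ ⟩
        κ * q (suc n) (2 ℕ.+ k) ∎

    σ₃≈q : ∀ n → σ₃ (double n) 1 ≈ q n 0
    σ₃≈q n = σ₃≈κq n 0

  -- Walks with a mark: the step weights before and after it are `wα` and `wβ`.

  wα wβ : ℕ → ℕ → Carrier
  wα 2 1 = α
  wα _ _ = 1#
  wβ 1 2 = β
  wβ _ _ = 1#

  σβ : ℕ → ℕ → Carrier
  σβ = walkSum posNeighbours wβ δ₁

  markHere : ℕ → ℕ → Carrier
  markHere n 1 = σβ n 1
  markHere n _ = 0#

  -- The walks counted by σ₄ still have their mark ahead of them.
  σ₄ : ℕ → ℕ → Carrier
  σ₄ zero    h = markHere zero h
  σ₄ (suc n) h = markHere (suc n) h + ∑ (posNeighbours h) λ h′ → wα h h′ * σ₄ n h′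

  private
    B : ℕ → ℕ → Carrier
    B n k = σβ (double n) (odd k)

    r : ℕ → ℕ → Carrier
    r n k = q n k + γ * q n (suc k)

    -- This is the boundary recurrence that `B-zero` and `B-suc` impose on B n 0 + B n 1; for `r` it
    -- rests on α + γ = 1.
    r-zero : ∀ n → r (suc n) 0 ≈ β * r n 0 + (r n 0 + r n 1)
    r-zero n = begin
      ((α + β) * x + (α + β * γ) * y) + γ * (x + (y + y) + z)
        ≈⟨ solve 6 (λ α β γ x y z →
             ((α :+ β) :* x :+ (α :+ β :* γ) :* y) :+ γ :* (x :+ (y :+ y) :+ z)
               := β :* (x :+ γ :* y)
                  :+ (((α :+ γ) :* x :+ γ :* y) :+ ((α :+ γ) :* y :+ γ :* z)))
             refl α β γ x y z ⟩
      β * r n 0 + (((α + γ) * x + γ * y) + ((α + γ) * y + γ * z))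
        ≈⟨ +-congˡ (+-cong (+-congʳ (trans (*-congʳ α+γ≈1) (*-identityˡ x)))
                           (+-congʳ (trans (*-congʳ α+γ≈1) (*-identityˡ y)))) ⟩
      β * r n 0 + (r n 0 + r n 1) ∎
      where
        x = q n 0
        y = q n 1
        z = q n 2

    B-zero : ∀ n → B (suc n) 0 ≈ β * (B n 0 + B n 1)
    B-zero n = solve 3 (λ β x y → β :* (con 1 :* x :+ (con 1 :* y :+ con 0)) :+ con 0
                          := β :* (x :+ y)) refl β (B n 0) (B n 1)

    B-suc : ∀ n k → B (suc n) (suc k) ≈ B n k + (B n (1 ℕ.+ k) + B n (1 ℕ.+ k)) + B n (2 ℕ.+ k)
    B-suc n zero    = interior (B n 0) (B n 1) (B n 2)
    B-suc n (suc k) = interior (B n (1 ℕ.+ k)) (B n (2 ℕ.+ k)) (B n (3 ℕ.+ k))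

    -- As generating functions, B k = tᵏ / (1 - β s) and (1 + t)(1 - α s) = 1 + γ t.
    B+B≈r : ∀ n k → B n k + B n (suc k) ≈ r n k
    B+B≈r zero    zero    = +-congˡ (sym (zeroʳ γ))
    B+B≈r zero    (suc k) = +-congˡ (sym (zeroʳ γ))
    B+B≈r (suc n) zero    = begin
      B (suc n) 0 + B (suc n) 1
        ≈⟨ +-cong (B-zero n) (B-suc n 0) ⟩
      β * (B n 0 + B n 1) + (B n 0 + (B n 1 + B n 1) + B n 2)
        ≈⟨ +-congˡ (solve 3 (λ x y z → x :+ (y :+ y) :+ z := (x :+ y) :+ (y :+ z)) refl
             (B n 0) (B n 1) (B n 2)) ⟩
      β * (B n 0 + B n 1) + ((B n 0 + B n 1) + (B n 1 + B n 2))
        ≈⟨ +-cong (*-congˡ (B+B≈r n 0)) (+-cong (B+B≈r n 0) (B+B≈r n 1)) ⟩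
      β * r n 0 + (r n 0 + r n 1)
        ≈⟨ r-zero n ⟨
      r (suc n) 0 ∎
    B+B≈r (suc n) (suc k) = begin
      B (suc n) (1 ℕ.+ k) + B (suc n) (2 ℕ.+ k)
        ≈⟨ +-cong (B-suc n k) (B-suc n (suc k)) ⟩
      _ ≈⟨ solve 4 (λ x y z w → (x :+ (y :+ y) :+ z) :+ (y :+ (z :+ z) :+ w)
                      := (x :+ y) :+ ((y :+ z) :+ (y :+ z)) :+ (z :+ w)) refl
             (B n k) (B n (1 ℕ.+ k)) (B n (2 ℕ.+ k)) (B n (3 ℕ.+ k)) ⟩
      _ ≈⟨ +-cong (+-cong (B+B≈r n k) (+-cong (B+B≈r n (1 ℕ.+ k)) (B+B≈r n (1 ℕ.+ k))))
             (B+B≈r n (2 ℕ.+ k)) ⟩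
      r n k + (r n (1 ℕ.+ k) + r n (1 ℕ.+ k)) + r n (2 ℕ.+ k)
        ≈⟨ solve 5 (λ γ x y z w →
             (x :+ γ :* y) :+ ((y :+ γ :* z) :+ (y :+ γ :* z)) :+ (z :+ γ :* w)
               := (x :+ (y :+ y) :+ z) :+ γ :* (y :+ (z :+ z) :+ w)) refl
             γ (q n k) (q n (1 ℕ.+ k)) (q n (2 ℕ.+ k)) (q n (3 ℕ.+ k)) ⟩
      r (suc n) (suc k) ∎

    αq : ℕ → ℕ → Carrier
    αq n zero    = q n 0
    αq n (suc k) = α * q n (suc k)

    -- At height 1 a mark on the present vertex contributes B (n+1) 0 = β (q n 0 + γ q n 1) and a
    -- later mark contributes α q n 0 + α q n 1. The coefficient of q n 1 is then α + β γ = μ.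
    σ₄≈αq : ∀ n k → σ₄ (double n) (odd k) ≈ αq n k
    σ₄≈αq zero    zero          = refl
    σ₄≈αq zero    (suc k)       = sym (zeroʳ α)
    σ₄≈αq (suc n) zero          = begin
      B (suc n) 0 + (1# * (0# + (α * x + (1# * y + 0#))) + 0#)
        ≈⟨ +-cong (trans (B-zero n) (*-congˡ (B+B≈r n 0)))
             (+-congʳ (*-congˡ (+-congˡ (+-cong (*-congˡ (σ₄≈αq n 0))
                                                (+-congʳ (*-congˡ (σ₄≈αq n 1))))))) ⟩
      β * (q n 0 + γ * q n 1)
        + (1# * (0# + (α * q n 0 + (1# * (α * q n 1) + 0#))) + 0#)
        ≈⟨ solve 5 (λ α β γ x y →
             β :* (x :+ γ :* y)
               :+ (con 1 :* (con 0 :+ (α :* x :+ (con 1 :* (α :* y) :+ con 0))) :+ con 0)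
               := (α :+ β) :* x :+ (α :+ β :* γ) :* y) refl α β γ (q n 0) (q n 1) ⟩
      (α + β) * q n 0 + μ * q n 1 ∎
      where
        x = σ₄ (double n) 1
        y = σ₄ (double n) 3
    σ₄≈αq (suc n) (suc zero)    = begin
      0# + (1# * (0# + (α * x + (1# * y + 0#)))
            + (1# * (0# + (1# * y + (1# * z + 0#))) + 0#))
        ≈⟨ +-congˡ (+-cong
             (*-congˡ (+-congˡ (+-cong (*-congˡ (σ₄≈αq n 0)) (+-congʳ (*-congˡ (σ₄≈αq n 1))))))
             (+-congʳ (*-congˡ (+-congˡ (+-cong (*-congˡ (σ₄≈αq n 1))
                                                (+-congʳ (*-congˡ (σ₄≈αq n 2)))))))) ⟩
      0# + (1# * (0# + (α * q n 0 + (1# * (α * q n 1) + 0#)))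
            + (1# * (0# + (1# * (α * q n 1) + (1# * (α * q n 2) + 0#))) + 0#))
        ≈⟨ solve 4 (λ α x y z →
             con 0 :+ (con 1 :* (con 0 :+ (α :* x :+ (con 1 :* (α :* y) :+ con 0)))
               :+ (con 1 :* (con 0 :+ (con 1 :* (α :* y) :+ (con 1 :* (α :* z) :+ con 0)))
                   :+ con 0))
               := α :* (x :+ (y :+ y) :+ z)) refl α (q n 0) (q n 1) (q n 2) ⟩
      α * q (suc n) 1 ∎
      where
        x = σ₄ (double n) 1
        y = σ₄ (double n) 3
        z = σ₄ (double n) 5
    σ₄≈αq (suc n) (suc (suc k)) = begin
      0# + (1# * (0# + (1# * x + (1# * y + 0#)))
            + (1# * (0# + (1# * y + (1# * z + 0#))) + 0#))
        ≈⟨ solve 3 (λ x y z →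
             con 0 :+ (con 1 :* (con 0 :+ (con 1 :* x :+ (con 1 :* y :+ con 0)))
               :+ (con 1 :* (con 0 :+ (con 1 :* y :+ (con 1 :* z :+ con 0))) :+ con 0))
               := x :+ (y :+ y) :+ z) refl x y z ⟩
      x + (y + y) + z
        ≈⟨ +-cong (+-cong (σ₄≈αq n (1 ℕ.+ k)) (+-cong (σ₄≈αq n (2 ℕ.+ k)) (σ₄≈αq n (2 ℕ.+ k))))
             (σ₄≈αq n (3 ℕ.+ k)) ⟩
      _ ≈⟨ solve 4 (λ α x y z → α :* x :+ (α :* y :+ α :* y) :+ α :* z
                      := α :* (x :+ (y :+ y) :+ z)) refl α _ _ _ ⟩
      α * q (suc n) (2 ℕ.+ k) ∎
      where
        x = σ₄ (double n) (odd (1 ℕ.+ k))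
        y = σ₄ (double n) (odd (2 ℕ.+ k))
        z = σ₄ (double n) (odd (3 ℕ.+ k))

  σ₄≈q : ∀ n → σ₄ (double n) 1 ≈ q n 0
  σ₄≈q n = σ₄≈αq n 0

  -- qδ n k is φ ((D - 1)ᵏ (DE)ⁿ).
  qδ : ℕ → ℕ → Carrier
  qδ n zero    = q n 0
  qδ n (suc k) = d * qδ n k + μ * q n (suc k)

  private
    qδ-zero : ∀ n → qδ (suc n) 0 ≈ (1# + 1# + c) * qδ n 0 + qδ n 1
    qδ-zero n = solve 4 (λ c d x y →
      (con 1 :+ c :+ (con 1 :+ d)) :* x :+ y
        := (con 1 :+ con 1 :+ c) :* x :+ (d :* x :+ y)) refl c d (q n 0) (μ * q n 1)

    -- For k = 0 the coefficient of q n 0 works out as μ + c d = 1. For larger k the rule is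
    -- inherited from those of `qδ` and `q`, of which `qδ` is a linear combination.
    qδ-suc : ∀ n k → qδ (suc n) (suc k)
      ≈ qδ n k + (qδ n (1 ℕ.+ k) + qδ n (1 ℕ.+ k)) + qδ n (2 ℕ.+ k)
    qδ-suc n zero = begin
      d * qδ (suc n) 0 + μ * q (suc n) 1
        ≈⟨ +-congʳ (*-congˡ (qδ-zero n)) ⟩
      d * ((1# + 1# + c) * x + (d * x + μ * y)) + μ * (x + (y + y) + z)
        ≈⟨ solve 6 (λ c d μ x y z →
             d :* ((con 1 :+ con 1 :+ c) :* x :+ (d :* x :+ μ :* y)) :+ μ :* (x :+ (y :+ y) :+ z)
               := (μ :+ c :* d) :* x :+ ((d :* x :+ μ :* y) :+ (d :* x :+ μ :* y))
                  :+ (d :* (d :* x :+ μ :* y) :+ μ :* z)) refl c d μ x y z ⟩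
      (μ + c * d) * x + (qδ n 1 + qδ n 1) + qδ n 2
        ≈⟨ +-congʳ (+-congʳ (trans (*-congʳ μ+cd≈1) (*-identityˡ x))) ⟩
      qδ n 0 + (qδ n 1 + qδ n 1) + qδ n 2 ∎
      where
        x = q n 0
        y = q n 1
        z = q n 2
    qδ-suc n (suc k) = begin
      d * qδ (suc n) (suc k) + μ * q (suc n) (2 ℕ.+ k)
        ≈⟨ +-congʳ (*-congˡ (qδ-suc n k)) ⟩
      _ ≈⟨ solve 8 (λ d μ x y z u v w →
             d :* (x :+ (y :+ y) :+ z) :+ μ :* (u :+ (v :+ v) :+ w)
               := (d :* x :+ μ :* u) :+ ((d :* y :+ μ :* v) :+ (d :* y :+ μ :* v))
                  :+ (d :* z :+ μ :* w)) refl d μ _ _ _ _ _ _ ⟩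
      qδ n (1 ℕ.+ k) + (qδ n (2 ℕ.+ k) + qδ n (2 ℕ.+ k)) + qδ n (3 ℕ.+ k) ∎

  -- Walks with the weights of R₂ and truncated sums over their starting height.

  module R₂-Sum (κ : Carrier) (κ²≈1-cd : κ * κ ≈ 1# - c * d) where

    private
      κ²≈μ : κ * κ ≈ μ
      κ²≈μ = trans κ²≈1-cd (sym μ≈1-cd)

    -- The final weight of R₂, extended by zero to even heights, where no path may end; recursion by
    -- two avoids a parity test.
    v₂ : ℕ → Carrier
    v₂ zero          = 0#
    v₂ (suc zero)    = κ
    v₂ (suc (suc h)) = d * v₂ h

    σ₂ : ℕ → ℕ → Carrier
    σ₂ = walkSum neighbours (λ _ _ → 1#) v₂

    v₂-odd : ∀ k → v₂ (odd k) ≈ κ * d ^ k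
    v₂-odd zero    = sym (*-identityʳ κ)
    v₂-odd (suc k) = trans (*-congˡ (v₂-odd k))
      (solve 3 (λ d κ p → d :* (κ :* p) := κ :* (d :* p)) refl d κ (d ^ k))

    v₂-double : ∀ k → v₂ (double k) ≈ 0#
    v₂-double zero    = refl
    v₂-double (suc k) = trans (*-congˡ (v₂-double k)) (zeroʳ d)

    infix 4 _≡_mod_

    -- The ring is arbitrary and has no infinite sums, so the series over starting heights is
    -- replaced by its truncations, compared modulo powers of c.
    _≡_mod_ : Carrier → Carrier → Carrier → Set (a ⊔ ℓ)
    x ≡ y mod p = ∃[ z ] x ≈ y + p * z

    private
      module _ {p : Carrier} where
        mod-trans : ∀ {x y z} → x ≡ y mod p → y ≡ z mod p → x ≡ z mod p
        mod-trans {x} {y} {z} (u , x≈) (v , y≈) = v + u , (begin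
          x                            ≈⟨ x≈ ⟩
          y + p * u                ≈⟨ +-congʳ y≈ ⟩
          (z + p * v) + p * u  ≈⟨ +-assoc _ _ _ ⟩
          z + (p * v + p * u)  ≈⟨ +-congˡ (distribˡ _ _ _) ⟨
          z + p * (v + u)          ∎)

        mod-reflexive : ∀ {x y} → x ≈ y → x ≡ y mod p
        mod-reflexive x≈y = 0# , trans x≈y (sym (trans (+-congˡ (zeroʳ _)) (+-identityʳ _)))

        mod-+ : ∀ {x x′ y y′} → x ≡ x′ mod p → y ≡ y′ mod p → x + y ≡ x′ + y′ mod p
        mod-+ {x′ = x′} {y′ = y′} (u , x≈) (v , y≈) = u + v , trans (+-cong x≈ y≈)
          (solve 5 (λ x y p u v → (x :+ p :* u) :+ (y :+ p :* v) := (x :+ y) :+ p :* (u :+ v))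
             refl x′ y′ p u v)

        mod-*ˡ : ∀ r {x y} → x ≡ y mod p → r * x ≡ r * y mod p
        mod-*ˡ r {y = y} (u , x≈) = r * u , trans (*-congˡ x≈)
          (solve 4 (λ r y p u → r :* (y :+ p :* u) := r :* y :+ p :* (r :* u))
             refl r y p u)

      g : ℕ → ℕ → Carrier
      g n k = σ₂ (double n) (odd k)

      g-zero : ∀ n → g (suc n) 0 ≈ (g n 0 + g n 0) + g n 1
      g-zero n = solve 2 (λ x y →
        con 1 :* (con 1 :* x :+ con 0) :+ (con 1 :* (con 1 :* x :+ (con 1 :* y :+ con 0)) :+ con 0)
          := (x :+ x) :+ y) refl (g n 0) (g n 1)

      g-suc : ∀ n k → g (suc n) (suc k) ≈ g n k + (g n (1 ℕ.+ k) + g n (1 ℕ.+ k)) + g n (2 ℕ.+ k)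
      g-suc n zero    = interior (g n 0) (g n 1) (g n 2)
      g-suc n (suc k) = interior (g n (1 ℕ.+ k)) (g n (2 ℕ.+ k)) (g n (3 ℕ.+ k))

      -- For k = 0, and multiplied by κ, this is the part of the R₂ sum with starting height below 2
      -- M + 1. The shift k makes the family closed under double steps.
      s : ℕ → ℕ → ℕ → Carrier
      s M n k = tailSum M (λ m → c ^ m * g n (k ℕ.+ m)) 0

      s-lap : ∀ M (x y z : ℕ → Carrier) →
        tailSum M (λ m → c ^ m * (x m + (y m + y m) + z m)) 0
          ≈ tailSum M (λ m → c ^ m * x m) 0
            + (tailSum M (λ m → c ^ m * y m) 0 + tailSum M (λ m → c ^ m * y m) 0)
            + tailSum M (λ m → c ^ m * z m) 0
      s-lap M x y z = begin
        tailSum M (λ m → c ^ m * (x m + (y m + y m) + z m)) 0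
          ≈⟨ tailSum-cong M (λ m → solve 4 (λ p x y z →
               p :* (x :+ (y :+ y) :+ z) := (p :* x :+ (p :* y :+ p :* y)) :+ p :* z)
               refl (c ^ m) (x m) (y m) (z m)) 0 ⟩
        _ ≈⟨ tailSum-+ M (λ m → c ^ m * x m + (c ^ m * y m + c ^ m * y m)) (λ m → c ^ m * z m) ⟩
        _ ≈⟨ +-congʳ (tailSum-+ M (λ m → c ^ m * x m) (λ m → c ^ m * y m + c ^ m * y m)) ⟩
        _ ≈⟨ +-congʳ (+-congˡ (tailSum-+ M (λ m → c ^ m * y m) (λ m → c ^ m * y m))) ⟩
        _ ∎

      s-suc : ∀ M n k → s M (suc n) (suc k)
        ≈ s M n k + (s M n (1 ℕ.+ k) + s M n (1 ℕ.+ k)) + s M n (2 ℕ.+ k)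
      s-suc M n k = trans (tailSum-cong M (λ m → *-congˡ (g-suc n (k ℕ.+ m))) 0)
        (s-lap M (λ m → g n (k ℕ.+ m)) (λ m → g n (1 ℕ.+ k ℕ.+ m)) (λ m → g n (2 ℕ.+ k ℕ.+ m)))

      -- Only the term m = 0 lies at the boundary. The terms with m ≥ 1 can also step down to m - 1,
      -- which produces the last summand, with one factor c and a cutoff lower by one.
      s-zero : ∀ M n → s (suc M) (suc n) 0
        ≈ (s (suc M) n 0 + s (suc M) n 0) + s (suc M) n 1 + c * s M n 0
      s-zero M n = begin
        1# * g (suc n) 0 + tailSum M (λ m → (c * c ^ m) * g (suc n) (suc m)) 0
          ≈⟨ +-cong (*-congˡ (g-zero n))
               (tailSum-cong M (λ m → trans (*-assoc _ _ _) (*-congˡ (*-congˡ (g-suc n m)))) 0) ⟩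
        1# * ((g n 0 + g n 0) + g n 1)
          + tailSum M (λ m → c * (c ^ m * (g n m + (g n (1 ℕ.+ m) + g n (1 ℕ.+ m)) + g n (2 ℕ.+ m)))) 0
          ≈⟨ +-congˡ (trans (tailSum-*ˡ M c _) (*-congˡ
               (s-lap M (g n) (λ m → g n (1 ℕ.+ m)) (λ m → g n (2 ℕ.+ m))))) ⟩
        1# * ((g n 0 + g n 0) + g n 1) + c * (s M n 0 + (s M n 1 + s M n 1) + s M n 2)
          ≈⟨ solve 6 (λ c x y u v w →
               con 1 :* ((x :+ x) :+ y) :+ c :* (u :+ (v :+ v) :+ w)
                 := ((con 1 :* x :+ c :* v) :+ (con 1 :* x :+ c :* v)) :+ (con 1 :* y :+ c :* w)
                    :+ c :* u)
               refl c (g n 0) (g n 1) (s M n 0) (s M n 1) (s M n 2) ⟩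
        ((1# * g n 0 + c * s M n 1) + (1# * g n 0 + c * s M n 1)) + (1# * g n 1 + c * s M n 2)
          + c * s M n 0
          ≈⟨ +-congʳ (+-cong (+-cong (s-cons 0) (s-cons 0)) (s-cons 1)) ⟩
        (s (suc M) n 0 + s (suc M) n 0) + s (suc M) n 1 + c * s M n 0 ∎
        where
        s-cons : ∀ k → 1# * g n k + c * s M n (suc k) ≈ s (suc M) n k
        s-cons k = +-cong (*-congˡ (reflexive (cong (g n) (≡.sym (ℕ.+-identityʳ k)))))
          (sym (trans (tailSum-cong M (λ m → trans
                  (*-congˡ (reflexive (cong (g n) (ℕ.+-suc k m)))) (*-assoc _ _ _)) 0)
                (tailSum-*ˡ M c _)))

      truncate : ∀ M n → c * s M n 0 ≡ c * s (suc M) n 0 mod c ^ suc M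
      -- The two cutoffs differ by the term m = M, which after the factor c is c^(M+1) g n M.
      truncate M n = - g n M , (begin
        c * s M n 0
          ≈⟨ +-identityʳ _ ⟨
        c * s M n 0 + 0#
          ≈⟨ +-congˡ (trans (*-congˡ (-‿inverseʳ _)) (zeroʳ _)) ⟨
        c * s M n 0 + (c * c ^ M) * (g n M - g n M)
          ≈⟨ solve 5 (λ c s p x y → c :* s :+ (c :* p) :* (x :+ y)
                        := c :* (s :+ p :* x) :+ (c :* p) :* y)
               refl c (s M n 0) (c ^ M) (g n M) (- g n M) ⟩
        c * (s M n 0 + c ^ M * g n M) + (c * c ^ M) * - g n M
          ≈⟨ +-congʳ (*-congˡ (tailSum-snoc M (λ m → c ^ m * g n m))) ⟨
        c * s (suc M) n 0 + c ^ suc M * - g n M ∎)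

      geometric : ∀ M k → κ * s M 0 k + c ^ M * d ^ (k ℕ.+ M) ≈ d ^ k
      geometric zero k = trans (+-cong (zeroʳ κ) (*-identityˡ _))
        (trans (+-identityˡ _) (reflexive (cong (d ^_) (ℕ.+-identityʳ k))))
      geometric (suc M) k = begin
        κ * s (suc M) 0 k + c ^ suc M * d ^ (k ℕ.+ suc M)
          ≈⟨ +-cong (*-congˡ (trans (tailSum-snoc M (λ m → c ^ m * g 0 (k ℕ.+ m)))
                                    (+-congˡ (*-congˡ (v₂-odd (k ℕ.+ M))))))
               (*-congˡ (reflexive (cong (d ^_) (ℕ.+-suc k M)))) ⟩
        κ * (s M 0 k + c ^ M * (κ * d ^ (k ℕ.+ M))) + (c * c ^ M) * (d * d ^ (k ℕ.+ M))
          ≈⟨ solve 6 (λ c d κ s p r →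
               κ :* (s :+ p :* (κ :* r)) :+ (c :* p) :* (d :* r)
                 := κ :* s :+ (κ :* κ :+ c :* d) :* (p :* r))
               refl c d κ (s M 0 k) (c ^ M) (d ^ (k ℕ.+ M)) ⟩
        κ * s M 0 k + (κ * κ + c * d) * (c ^ M * d ^ (k ℕ.+ M))
          ≈⟨ +-congˡ (trans (*-congʳ (trans (+-congʳ κ²≈μ) μ+cd≈1)) (*-identityˡ _)) ⟩
        κ * s M 0 k + c ^ M * d ^ (k ℕ.+ M)
          ≈⟨ geometric M k ⟩
        d ^ k ∎

      qδ-init : ∀ k → qδ 0 k ≈ d ^ k
      qδ-init zero    = refl
      qδ-init (suc k) = trans (+-cong (*-congˡ (qδ-init k)) (zeroʳ μ)) (+-identityʳ _)

      -- Both sides obey the same recurrences in n, except for the error of `truncate`, which the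
      -- modulus absorbs; `geometric` settles n = 0.
      κs≡qδ : ∀ M n k → κ * s (suc M) n k ≡ qδ n k mod c ^ suc M
      -- `p * e` is the remainder of the geometric series.
      κs≡qδ M zero k = - e , (begin
        x              ≈⟨ +-identityʳ x ⟨
        x + 0#         ≈⟨ +-congˡ (trans (*-congˡ (-‿inverseʳ e)) (zeroʳ p)) ⟨
        x + p * (e - e)
          ≈⟨ solve 4 (λ x p u v → x :+ p :* (u :+ v) := (x :+ p :* u) :+ p :* v) refl x p e (- e) ⟩
        (x + p * e) + p * - e
          ≈⟨ +-congʳ (trans (geometric (suc M) k) (sym (qδ-init k))) ⟩
        qδ 0 k + p * - e ∎)
        where
          x = κ * s (suc M) 0 k
          p = c ^ suc M
          e = d ^ (k ℕ.+ suc M)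
      κs≡qδ M (suc n) zero =
        mod-trans (mod-reflexive (trans (*-congˡ (s-zero M n))
          (solve 4 (λ κ x y z → κ :* (x :+ x :+ y :+ z)
                      := (κ :* x :+ κ :* x) :+ κ :* y :+ κ :* z) refl κ _ _ _)))
        (mod-trans (mod-+ (mod-+ (mod-+ (κs≡qδ M n 0) (κs≡qδ M n 0)) (κs≡qδ M n 1))
          -- The last summand of `s-zero` still has the lower cutoff and must be raised before the
          -- induction hypothesis applies.
          (mod-trans (mod-*ˡ κ (truncate M n))
          (mod-trans (mod-reflexive
            (solve 3 (λ c κ x → κ :* (c :* x) := c :* (κ :* x)) refl c κ (s (suc M) n 0)))
            (mod-*ˡ c (κs≡qδ M n 0)))))
        (mod-reflexive (trans
          (solve 3 (λ c x y → x :+ x :+ y :+ c :* x := (con 1 :+ con 1 :+ c) :* x :+ y)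
             refl c (qδ n 0) (qδ n 1))
          (sym (qδ-zero n)))))
      κs≡qδ M (suc n) (suc k) =
        mod-trans (mod-reflexive (trans (*-congˡ (s-suc (suc M) n k))
          (solve 4 (λ κ x y z → κ :* (x :+ (y :+ y) :+ z)
                      := κ :* x :+ (κ :* y :+ κ :* y) :+ κ :* z) refl κ _ _ _)))
        (mod-trans (mod-+ (mod-+ (κs≡qδ M n k)
            (mod-+ (κs≡qδ M n (1 ℕ.+ k)) (κs≡qδ M n (1 ℕ.+ k))))
          (κs≡qδ M n (2 ℕ.+ k)))
        (mod-reflexive (sym (qδ-suc n k))))

    Σσ₂≡q : ∀ M n →
      tailSum (suc M) (λ k → κ * c ^ k * σ₂ (double n) (odd k)) 0 ≡ q n 0 mod c ^ suc M
    Σσ₂≡q M n = mod-trans (mod-reflexive (trans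
      (tailSum-cong (suc M) (λ k → *-assoc κ (c ^ k) (g n k)) 0)
      (tailSum-*ˡ (suc M) κ (λ k → c ^ k * g n k)))) (κs≡qδ M n 0)

open ≡ using (refl)
open Sums 𝕂
open Recurrences 𝕂 c d
open Equivalence using (to; from)
open RawSemiring (Semiring.rawSemiring 𝕂.semiring) using (product) renaming (_^_ to _^ᴷ_)

-- The algebra side

open RawSemiring (Semiring.rawSemiring (Ring.semiring 𝔸)) using () renaming (_^_ to _^ᴬ_)

module DEHP (Φ : DEHPFunctional) where
  open DEHPFunctional Φ
  open Ring 𝔸 using (setoid; *-congˡ; *-congʳ; *-assoc; *-identityʳ)
  open SetoidReasoning setoid

  T : Expr
  T = D ⊗ E

  f : ℕ → ℕ → 𝕂.Carrier
  f n k = φ ((T ^ᴬ n) ⊗ (E ^ᴬ k))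

  -- Powers unfold on the left, but the relation DE = D + E has to be applied to the rightmost
  -- factor, next to Eᵏ.
  T^suc : ∀ n x → (T ^ᴬ suc n) ⊗ x ≋ (T ^ᴬ n) ⊗ (T ⊗ x)
  T^suc zero    x = begin
    (T ⊗ ι 𝕂.1#) ⊗ x  ≈⟨ *-congʳ (*-identityʳ T) ⟩
    T ⊗ x             ≈⟨ ⊗-identityˡ _ ⟨
    ι 𝕂.1# ⊗ (T ⊗ x)  ∎
  T^suc (suc n) x = begin
    (T ⊗ (T ^ᴬ suc n)) ⊗ x      ≈⟨ *-assoc _ _ _ ⟩
    T ⊗ ((T ^ᴬ suc n) ⊗ x)      ≈⟨ *-congˡ (T^suc n x) ⟩
    T ⊗ ((T ^ᴬ n) ⊗ (T ⊗ x))    ≈⟨ *-assoc _ _ _ ⟨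
    (T ^ᴬ suc n) ⊗ (T ⊗ x)      ∎

  DE⊗ : ∀ x → D ⊗ (E ⊗ x) ≋ D ⊗ x ⊕ E ⊗ x
  DE⊗ x = begin
    D ⊗ (E ⊗ x)    ≈⟨ *-assoc _ _ _ ⟨
    (D ⊗ E) ⊗ x    ≈⟨ *-congʳ DE≋D+E ⟩
    (D ⊕ E) ⊗ x    ≈⟨ ⊗-distribʳ _ _ _ ⟩
    D ⊗ x ⊕ E ⊗ x  ∎

  φ-⊕ : ∀ x y z → φ (x ⊗ (y ⊕ z)) 𝕂.≈ φ (x ⊗ y) 𝕂.+ φ (x ⊗ z)
  φ-⊕ x y z = 𝕂.trans (φ-cong (⊗-distribˡ x y z)) (φ-+ _ _)

  -- In this form one use of `DE⊗` lowers the power of E behind D by one. For k = 0 it leaves a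
  -- final D, which φ turns into β.
  f-suc-DE : ∀ n k → f (suc n) k 𝕂.≈ φ ((T ^ᴬ n) ⊗ (D ⊗ (E ^ᴬ suc k)))
  f-suc-DE n k = φ-cong (≋-trans (T^suc n _) (*-congˡ (*-assoc D E _)))

  f-init : ∀ k → f 0 k 𝕂.≈ α ^ᴷ k
  f-init k = 𝕂.trans (φ-cong (⊗-identityˡ _)) (φE^ k)
    where
    φE^ : ∀ k → φ (E ^ᴬ k) 𝕂.≈ α ^ᴷ k
    φE^ zero    = φ-1
    φE^ (suc k) = 𝕂.trans (φ-E _) (𝕂.*-congˡ {α} (φE^ k))

  f-zero : ∀ n → f (suc n) 0 𝕂.≈ β 𝕂.* f n 0 𝕂.+ f n 1
  f-zero n =
    𝕂.trans (f-suc-DE n 0)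
    (𝕂.trans (φ-cong (*-congˡ (DE⊗ (ι 𝕂.1#))))
    (𝕂.trans (φ-⊕ (T ^ᴬ n) (D ⊗ ι 𝕂.1#) (E ⊗ ι 𝕂.1#))
    (𝕂.+-congʳ {f n 1} (𝕂.trans (φ-cong T^nD) (φ-D _)))))
    where
    T^nD : (T ^ᴬ n) ⊗ (D ⊗ ι 𝕂.1#) ≋ ((T ^ᴬ n) ⊗ ι 𝕂.1#) ⊗ D
    T^nD = ≋-trans (*-congˡ (*-identityʳ D)) (*-congʳ (≋-sym (*-identityʳ _)))

  f-suc : ∀ n k → f (suc n) (suc k) 𝕂.≈ f (suc n) k 𝕂.+ f n (2 ℕ.+ k)
  f-suc n k =
    𝕂.trans (f-suc-DE n (suc k))
    (𝕂.trans (φ-cong (*-congˡ (DE⊗ (E ^ᴬ suc k))))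
    (𝕂.trans (φ-⊕ (T ^ᴬ n) (D ⊗ (E ^ᴬ suc k)) (E ^ᴬ (2 ℕ.+ k)))
    (𝕂.+-congʳ {f n (2 ℕ.+ k)} (𝕂.sym (f-suc-DE n k)))))

  f≈normalisation : ∀ n → f n 0 𝕂.≈ normalisation Φ n
  f≈normalisation n = φ-cong (*-identityʳ _)

  open Powers f f-init f-zero f-suc public

-- Finite sums and walks

private
  variable
    A B : Set


finiteSum-resp : ∀ {P Q : A → Set} {w s t} → (∀ x → P x → Q x) → (∀ x → Q x → P x) →
                 s 𝕂.≈ t → FiniteSum P w s → FiniteSum Q w t
finiteSum-resp P⇒Q Q⇒P s≈t (xs , unique , xs⇔P , sum) =
  xs , unique
  , (λ x → mk⇔ (P⇒Q x ∘ to (xs⇔P x)) (from (xs⇔P x) ∘ Q⇒P x))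
  , 𝕂.trans sum s≈t

finiteSum-∅ : ∀ {P : A → Set} {w} → (∀ x → ¬ P x) → FiniteSum P w 𝕂.0#
finiteSum-∅ ¬P = [] , AllPairs.[] , (λ x → mk⇔ (λ ()) (⊥-elim ∘ ¬P x)) , 𝕂.refl

finiteSum-singleton : ∀ {P : A → Set} {w} a → P a → (∀ x → P x → x ≡ a) → FiniteSum P w (w a)
finiteSum-singleton {P = P} {w} a Pa P⇒≡ =
  (a ∷ []) , All.[] AllPairs.∷ AllPairs.[]
  , (λ x → mk⇔ (λ { (here refl) → Pa }) (here ∘ P⇒≡ x))
  , 𝕂.+-identityʳ (w a)

finiteSum-⊎ : ∀ {P Q : A → Set} {w s t} → (∀ x → P x → ¬ Q x) →
              FiniteSum P w s → FiniteSum Q w t → FiniteSum (λ x → P x ⊎ Q x) w (s 𝕂.+ t)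
finiteSum-⊎ {w = w} {s} {t} disjoint (xs , xs! , xs⇔P , xs-sum) (ys , ys! , ys⇔Q , ys-sum) =
  xs ++ ys
  , ++⁺ xs! ys! (λ { {x} (x∈xs , x∈ys) → disjoint x (to (xs⇔P x) x∈xs) (to (ys⇔Q x) x∈ys) })
  , (λ x → mk⇔
      ([ inj₁ ∘ to (xs⇔P x) , inj₂ ∘ to (ys⇔Q x) ]′ ∘ ∈-++⁻ xs)
      [ ∈-++⁺ˡ ∘ from (xs⇔P x) , ∈-++⁺ʳ xs ∘ from (ys⇔Q x) ]′)
  , 𝕂.trans (∑-++ xs ys w) (𝕂.+-cong {∑ xs w} {s} {∑ ys w} {t} xs-sum ys-sum)

finiteSum-⋃ : ∀ {I : Set} {P : I → A → Set} {w s} is → Unique is →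
              (∀ {i j x} → P i x → P j x → i ≡ j) →
              (∀ {i} → i ∈ is → FiniteSum (P i) w (s i)) →
              FiniteSum (λ x → ∃[ i ] i ∈ is × P i x) w (∑ is s)
finiteSum-⋃ [] _ _ _ = finiteSum-∅ (λ { _ (_ , () , _) })
finiteSum-⋃ {P = P} {s = s} (i ∷ is) is!@(_ AllPairs.∷ is!′) disjoint sums =
  finiteSum-resp
    (λ { x (inj₁ Pix)             → i , here refl , Pix
       ; x (inj₂ (j , j∈is , Pj)) → j , there j∈is , Pj })
    (λ { x (j , here refl , Pj)   → inj₁ Pj
       ; x (j , there j∈is , Pj)  → inj₂ (j , j∈is , Pj) })
    (𝕂.refl {s i 𝕂.+ ∑ is s})
    (finiteSum-⊎
      (λ { x Pi (j , j∈is , Pj) →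
             Unique[x∷xs]⇒x∉xs is! (≡.subst (_∈ is) (disjoint Pj Pi) j∈is) })
      (sums (here refl))
      (finiteSum-⋃ is is!′ disjoint (sums ∘ there)))

-- The factor `r` absorbs the weight of a prepended step or of an initial vertex.
finiteSum-image : ∀ {P : A → Set} {w s} (f : A → B) {w′} r →
                  (∀ {x y} → f x ≡ f y → x ≡ y) →
                  (∀ x → w′ (f x) 𝕂.≈ r 𝕂.* w x) →
                  FiniteSum P w s → FiniteSum (λ y → ∃[ x ] y ≡ f x × P x) w′ (r 𝕂.* s)
finiteSum-image {w = w} {s} f {w′} r f-inj w′f (xs , xs! , xs⇔P , sum) =
  map f xs , map⁺ f-inj xs!
  , (λ y → mk⇔
      (λ y∈ → let x , x∈xs , y≡fx = ∈-map⁻ f y∈ in x , y≡fx , to (xs⇔P x) x∈xs)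
      (λ { (x , refl , Px) → ∈-map⁺ f (from (xs⇔P x) Px) }))
  , 𝕂.trans (∑-map f xs w′)
    (𝕂.trans (∑-cong xs w′f) (𝕂.trans (∑-*ˡ r xs w) (𝕂.*-congˡ {r} {∑ xs w} {s} sum)))

-- The vector holds the heights after the first one. The step relation is shifted along the walk
-- because the steps of R₁ depend on their number; the same shift of the weights serves R₁ and R₄.
Walk : (ℕ → ℕ → ℕ → Set) → (ℕ → Set) → ℕ → ∀ {n} → Vec ℕ n → Set
Walk S V h []        = V h
Walk S V h (h′ ∷ hs) = S 0 h h′ × Walk (S ∘ suc) V h′ hs

walkWeight : (ℕ → ℕ → ℕ → 𝕂.Carrier) → (ℕ → 𝕂.Carrier) → ℕ → ∀ {n} → Vec ℕ n → 𝕂.Carrier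
walkWeight w v h []        = v h
walkWeight w v h (h′ ∷ hs) = w 0 h h′ 𝕂.* walkWeight (w ∘ suc) v h′ hs

module _ {I : Set} {n h : ℕ} {S : ℕ → ℕ → ℕ → Set} {V : ℕ → Set}
         {w : ℕ → ℕ → ℕ → 𝕂.Carrier} {v : ℕ → 𝕂.Carrier} {t : I → 𝕂.Carrier} where

  -- Completeness may look at the rest of the walk: R₁ admits infinitely many first steps, of which
  -- only finitely many can be continued to the prescribed end.
  finiteSum-∷ : (is : List I) (g : I → ℕ) → Unique is → (∀ {i j} → g i ≡ g j → i ≡ j) →
    (∀ {i} → i ∈ is → S 0 h (g i)) →
    (∀ h′ (hs : Vec ℕ n) → S 0 h h′ → Walk (S ∘ suc) V h′ hs → ∃[ i ] i ∈ is × h′ ≡ g i) →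
    (∀ {i} → i ∈ is → FiniteSum (Walk (S ∘ suc) V (g i) {n}) (walkWeight (w ∘ suc) v (g i)) (t i)) →
    FiniteSum (Walk S V h {suc n}) (walkWeight w v h) (∑ is λ i → w 0 h (g i) 𝕂.* t i)
  finiteSum-∷ is g is! g-inj sound complete sums =
    finiteSum-resp
      (λ { _ (i , i∈is , hs , refl , walk) → sound i∈is , walk })
      (λ { (h′ ∷ hs) (step , walk) → restore (complete h′ hs step walk) walk })
      (𝕂.refl {∑ is λ i → w 0 h (g i) 𝕂.* t i})
      (finiteSum-⋃ is is! (λ { (_ , refl , _) (_ , eq , _) → g-inj (∷-injectiveˡ eq) })
        (λ {i} i∈is → finiteSum-image (g i ∷_) (w 0 h (g i)) ∷-injectiveʳ
          (λ hs → 𝕂.refl {w 0 h (g i) 𝕂.* walkWeight (w ∘ suc) v (g i) hs}) (sums i∈is)))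
    where
    restore : ∀ {h′} {hs : Vec ℕ n} → (∃[ i ] i ∈ is × h′ ≡ g i) → Walk (S ∘ suc) V h′ hs →
              ∃[ i ] i ∈ is × ∃[ hs′ ] h′ Vec.∷ hs ≡ g i ∷ hs′ × Walk (S ∘ suc) V (g i) hs′
    restore {hs = hs} (i , i∈is , refl) walk = i , i∈is , hs , refl , walk

module _ {S : ℕ → ℕ → Set} {V : ℕ → Set} {w : ℕ → ℕ → 𝕂.Carrier} {v v′ : ℕ → 𝕂.Carrier}
         {cand : ℕ → List ℕ} where
  finiteSum-walks : (∀ h → Unique (cand h)) → (∀ {h h′} → h′ ∈ cand h ⇔ S h h′) →
    (∀ h → FiniteSum (Walk (λ _ → S) V h {0}) (walkWeight (λ _ → w) v h) (v′ h)) →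
    ∀ n h → FiniteSum (Walk (λ _ → S) V h {n}) (walkWeight (λ _ → w) v h)
              (walkSum cand w v′ n h)
  finiteSum-walks cand! cand⇔S base zero    h = base h
  finiteSum-walks cand! cand⇔S base (suc n) h =
    finiteSum-∷ (cand h) id (cand! h) id (to cand⇔S)
      (λ h′ _ step _ → h′ , from cand⇔S step , refl)
      (λ {h′} _ → finiteSum-walks cand! cand⇔S base n h′)

-- Paths and their heights

+-diff⇒ : ∀ m n o p → + m ℤ.- + n ≡ + o ℤ.- + p → m ℕ.+ p ≡ o ℕ.+ n
+-diff⇒ m n o p eq = ℤ.+-injective (begin
  + m ℤ.+ + p                         ≡⟨ regroup (+ m) (+ n) (+ p) ⟩
  (+ m ℤ.- + n) ℤ.+ (+ n ℤ.+ + p)     ≡⟨ ≡.cong (ℤ._+ (+ n ℤ.+ + p)) eq ⟩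
  (+ o ℤ.- + p) ℤ.+ (+ n ℤ.+ + p)     ≡⟨ regroup′ (+ o) (+ n) (+ p) ⟩
  + o ℤ.+ + n                         ∎)
  where
  open ≡.≡-Reasoning
  regroup : ∀ m n p → m ℤ.+ p ≡ (m ℤ.- n) ℤ.+ (n ℤ.+ p)
  regroup = solve-∀
  regroup′ : ∀ o n p → (o ℤ.- p) ℤ.+ (n ℤ.+ p) ≡ o ℤ.+ n
  regroup′ = solve-∀

+-diff⇐ : ∀ m n o p → m ℕ.+ p ≡ o ℕ.+ n → + m ℤ.- + n ≡ + o ℤ.- + p
+-diff⇐ m n o p eq = begin
  + m ℤ.- + n                             ≡⟨ regroup (+ m) (+ n) (+ p) ⟩
  (+ m ℤ.+ + p) ℤ.- (+ n ℤ.+ + p)         ≡⟨ ≡.cong (ℤ._- (+ n ℤ.+ + p)) (≡.cong +_ eq) ⟩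
  (+ o ℤ.+ + n) ℤ.- (+ n ℤ.+ + p)         ≡⟨ regroup′ (+ o) (+ n) (+ p) ⟩
  + o ℤ.- + p                             ∎
  where
  open ≡.≡-Reasoning
  regroup : ∀ m n p → m ℤ.- n ≡ (m ℤ.+ p) ℤ.- (n ℤ.+ p)
  regroup = solve-∀
  regroup′ : ∀ o n p → (o ℤ.+ n) ℤ.- (n ℤ.+ p) ≡ o ℤ.- p
  regroup′ = solve-∀

-- All steps advance the abscissa by one, so the heights and the first abscissa determine a path.
place : ℕ → ℕ → ∀ {n} → Vec ℕ n → Vec Vertex (suc n)
place i h []        = (+ i , h) ∷ []
place i h (h′ ∷ hs) = (+ i , h) ∷ place (suc i) h′ hs

place-head : ∀ i h {n} (hs : Vec ℕ n) → head (place i h hs) ≡ (+ i , h)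
place-head i h []       = refl
place-head i h (_ ∷ _)  = refl

place-lookup : ∀ i h {n} (hs : Vec ℕ n) j →
               lookup (place i h hs) j ≡ (+ (i ℕ.+ toℕ j) , lookup (h ∷ hs) j)
place-lookup i h []        fzero    = ≡.cong (λ x → + x , h) (≡.sym (ℕ.+-identityʳ i))
place-lookup i h (h′ ∷ hs) fzero    = ≡.cong (λ x → + x , h) (≡.sym (ℕ.+-identityʳ i))
place-lookup i h (h′ ∷ hs) (fsuc j) = ≡.trans (place-lookup (suc i) h′ hs j)
  (≡.cong (λ x → + x , lookup (h′ ∷ hs) j) (≡.sym (ℕ.+-suc i (toℕ j))))

place-injective : ∀ i h {n} {hs hs′ : Vec ℕ n} → place i h hs ≡ place i h hs′ → hs ≡ hs′
place-injective i h {hs = []}     {[]}      eq = refl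
place-injective i h {hs = x ∷ xs} {y ∷ ys} eq =
  cons (≡.trans (≡.sym (place-head (suc i) x xs))
         (≡.trans (≡.cong (λ { (_ ∷ p) → head p }) eq) (place-head (suc i) y ys)))
       (≡.cong (λ { (_ ∷ p) → p }) eq)
  where
  cons : (+ suc i , x) ≡ (+ suc i , y) → place (suc i) x xs ≡ place (suc i) y ys →
         x Vec.∷ xs ≡ y ∷ ys
  cons refl eq′ = ≡.cong (x ∷_) (place-injective (suc i) x eq′)

Steps : (ℕ → ℤ × ℤ → Set) → ∀ {n} → Vec Vertex (suc n) → Set
Steps St {n} p = (j : Fin n) → St (toℕ j) (displacement (lookup p (inject₁ j)) (lookup p (fsuc j)))

heightStep : (ℕ → ℤ × ℤ → Set) → ℕ → ℕ → ℕ → Set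
heightStep St i h h′ = St i (1ℤ , + h′ ℤ.- + h)

suc-diff : ∀ i → + suc i ℤ.- + i ≡ 1ℤ
suc-diff i = +-diff⇐ (suc i) i 1 0 (ℕ.+-identityʳ (suc i))

diff-suc : ∀ {x} i → x ℤ.- + i ≡ 1ℤ → x ≡ + suc i
diff-suc {x} i eq = ≡.trans (regroup x (+ i)) (≡.cong (ℤ._+ + i) eq)
  where
  regroup : ∀ x i → x ≡ (x ℤ.- i) ℤ.+ i
  regroup = solve-∀

place-steps : ∀ St (End : Vertex → Set) m i h {n} (hs : Vec ℕ n) → i ℕ.+ n ≡ m →
  Walk (heightStep St) (λ h → End (+ m , h)) h hs →
  Steps St (place i h hs) × End (last (place i h hs))
place-steps St End m i h [] i+0≡m end =
  (λ ()) , ≡.subst (λ x → End (+ x , h)) (≡.trans (≡.sym i+0≡m) (ℕ.+-identityʳ i)) end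
place-steps St End m i h (h′ ∷ hs) i+n≡m (step , walk) = steps , proj₂ rest
  where
  rest = place-steps (St ∘ suc) End m (suc i) h′ hs
           (≡.trans (≡.sym (ℕ.+-suc i _)) i+n≡m) walk
  steps : Steps St (place i h (h′ ∷ hs))
  steps fzero    rewrite place-lookup (suc i) h′ hs fzero | ℕ.+-identityʳ i | suc-diff i = step
  steps (fsuc j) = proj₁ rest j

-- The hypothesis on the first component of the steps forces the abscissae one after the other.
place-complete : ∀ St (End : Vertex → Set) → (∀ {i δ} → St i δ → proj₁ δ ≡ 1ℤ) →
  ∀ m i h {n} (p : Vec Vertex (suc n)) → i ℕ.+ n ≡ m →
  head p ≡ (+ i , h) → End (last p) → Steps St p →
  ∃[ hs ] p ≡ place i h hs × Walk (heightStep St) (λ h → End (+ m , h)) h hs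
place-complete St End unit m i h (_ ∷ []) i+0≡m refl end steps =
  [] , refl , ≡.subst (λ x → End (+ x , h)) (≡.trans (≡.sym (ℕ.+-identityʳ i)) i+0≡m) end
place-complete St End unit m i h (_ ∷ (x , h′) ∷ p) i+n≡m refl end steps
  with refl ← diff-suc {x} i (unit (steps fzero))
  with hs , eq , walk ← place-complete (St ∘ suc) End unit m (suc i) h′ (_ ∷ p)
                            (≡.trans (≡.sym (ℕ.+-suc i _)) i+n≡m) refl end (steps ∘ fsuc)
  = h′ ∷ hs , ≡.cong (_ ∷_) eq , ≡.subst (λ y → St 0 (y , + h′ ℤ.- + h)) (suc-diff i) (steps fzero) , walk

place-weight : ∀ (w : ℕ → ℕ → ℕ → 𝕂.Carrier) v i h {n} (hs : Vec ℕ n) →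
  v (height (last (place i h hs))) 𝕂.*
    product {n} (λ j → w (toℕ j) (height (lookup (place i h hs) (inject₁ j)))
                                 (height (lookup (place i h hs) (fsuc j))))
  𝕂.≈ walkWeight w v h hs
place-weight w v i h []        = 𝕂.*-identityʳ (v h)
place-weight w v i h (h′ ∷ hs) rewrite place-lookup (suc i) h′ hs fzero =
  𝕂.trans (x∙yz≈y∙xz (v (height (last (place (suc i) h′ hs)))) (w 0 h h′) rest)
    (𝕂.*-congˡ {w 0 h h′} (place-weight (w ∘ suc) v (suc i) h′ hs))
  where
  open CommutativeSemigroupProperties 𝕂.*-commutativeSemigroup using (x∙yz≈y∙xz)
  rest = product λ j → w (suc (toℕ j)) (height (lookup (place (suc i) h′ hs) (inject₁ j)))
                                       (height (lookup (place (suc i) h′ hs) (fsuc j)))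

module FamilyPaths (F : Family) (L : ℕ)
  (unit : ∀ {i δ} → Family.StepSet F i δ → proj₁ δ ≡ 1ℤ)
  (w : ℕ → ℕ → ℕ → 𝕂.Carrier) (v : ℕ → 𝕂.Carrier)
  (stepWeight≡ : ∀ i x y → Family.stepWeight F (suc i) x y ≡ w i (height x) (height y))
  (finalWeight≡ : ∀ x → Family.finalWeight F x ≡ v (height x))
  where
  open Family F

  -- Walks number their steps from 0 and families from 1, hence the composition with `suc`.
  FWalk : ℕ → ∀ {n} → Vec ℕ n → Set
  FWalk = Walk (heightStep (StepSet ∘ suc)) (λ h → Final L (+ (2 ℕ.* L) , h))

  PathFrom : ℕ → Path L → Set
  PathFrom h p = head p ≡ (0ℤ , h) × Final L (last p) × Steps (StepSet ∘ suc) p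

  place-path : ∀ h hs → FWalk h hs → PathFrom h (place 0 h hs)
  place-path h hs walk = let steps , end = place-steps (StepSet ∘ suc) (Final L) _ 0 h hs refl walk in
    place-head 0 h hs , end , steps

  path-place : ∀ h p → PathFrom h p → ∃[ hs ] p ≡ place 0 h hs × FWalk h hs
  path-place h p (start , end , steps) =
    place-complete (StepSet ∘ suc) (Final L) (λ {i} {δ} → unit {suc i} {δ}) _ 0 h p refl start end steps

  weight-place : ∀ h hs →
    weight F L (place 0 h hs) 𝕂.≈ initialWeight (0ℤ , h) 𝕂.* walkWeight w v h hs
  weight-place h hs = 𝕂.trans
    (𝕂.*-assoc (initialWeight (head p)) (finalWeight (last p)) steps)
    (𝕂.*-cong {initialWeight (head p)} (𝕂.reflexive (≡.cong initialWeight (place-head 0 h hs)))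
      (𝕂.trans
        (𝕂.*-cong {finalWeight (last p)} {v (height (last p))} {steps}
          (𝕂.reflexive (finalWeight≡ (last p)))
          (product-cong (λ j → 𝕂.reflexive (stepWeight≡ (toℕ j) (lookup p (inject₁ j)) (lookup p (fsuc j))))))
        (place-weight w v 0 h hs)))
    where
    p = place 0 h hs
    steps = product λ j → stepWeight (suc (toℕ j)) (lookup p (inject₁ j)) (lookup p (fsuc j))
    product-cong : ∀ {n} {s t : Fin n → 𝕂.Carrier} → (∀ j → s j 𝕂.≈ t j) → product s 𝕂.≈ product t
    product-cong {zero}          s≈t = 𝕂.refl {𝕂.1#}
    product-cong {suc n} {s} {t} s≈t =
      𝕂.*-cong {s fzero} {t fzero} (s≈t fzero) (product-cong (s≈t ∘ fsuc))

  finiteSum-pathFrom : ∀ h {s} →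
    FiniteSum (FWalk h) (walkWeight w v h) s →
    FiniteSum (PathFrom h) (weight F L) (initialWeight (0ℤ , h) 𝕂.* s)
  finiteSum-pathFrom h {s} sum =
    finiteSum-resp (λ { _ (hs , refl , walk) → place-path h hs walk }) (path-place h)
      (𝕂.refl {initialWeight (0ℤ , h) 𝕂.* s})
      (finiteSum-image (place 0 h) (initialWeight (0ℤ , h)) (place-injective 0 h)
        (weight-place h) sum)

-- The four path families

double≡2* : ∀ n → double n ≡ 2 ℕ.* n
double≡2* zero    = refl
double≡2* (suc n) = ≡.trans (≡.cong (2 ℕ.+_) (double≡2* n)) (≡.sym (ℕ.*-suc 2 n))

odd≡2*+1 : ∀ k → odd k ≡ 2 ℕ.* k ℕ.+ 1
odd≡2*+1 zero    = refl
odd≡2*+1 (suc k) = ≡.trans (≡.cong (2 ℕ.+_) (odd≡2*+1 k)) (≡.sym (≡.cong (ℕ._+ 1) (ℕ.*-suc 2 k)))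

⌊odd/2⌋ : ∀ k → ⌊ odd k /2⌋ ≡ k
⌊odd/2⌋ zero    = refl
⌊odd/2⌋ (suc k) = ≡.cong suc (⌊odd/2⌋ k)

UpDown-unit : ∀ {δ} → UpDown δ → proj₁ δ ≡ 1ℤ
UpDown-unit up   = refl
UpDown-unit down = refl

UpDown⇒ : ∀ {δ} → UpDown δ → proj₂ δ ≡ + 1 ℤ.- + 0 ⊎ proj₂ δ ≡ + 0 ℤ.- + 1
UpDown⇒ up   = inj₁ refl
UpDown⇒ down = inj₂ refl

UpDownStep : ℕ → ℕ → Set
UpDownStep h h′ = UpDown (1ℤ , + h′ ℤ.- + h)

neighbours⇔UpDown : ∀ {h h′} → h′ ∈ neighbours h ⇔ UpDownStep h h′
neighbours⇔UpDown {h} {h′} = mk⇔ (sound h) (complete h ∘ UpDown⇒)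
  where
  up′ : ∀ h → UpDownStep h (suc h)
  up′ h = ≡.subst (λ x → UpDown (1ℤ , x)) (≡.sym (suc-diff h)) up
  down′ : ∀ h → UpDownStep (suc h) h
  down′ h = ≡.subst (λ x → UpDown (1ℤ , x)) (≡.sym (+-diff⇐ h (suc h) 0 1 (ℕ.+-comm h 1))) down
  sound : ∀ h {h′} → h′ ∈ neighbours h → UpDownStep h h′
  sound zero    (here refl)         = up′ 0
  sound (suc h) (here refl)         = down′ h
  sound (suc h) (there (here refl)) = up′ (suc h)
  from-up : ∀ h {h′} → h′ ≡ suc h → h′ ∈ neighbours h
  from-up zero    refl = here refl
  from-up (suc h) refl = there (here refl)
  from-down : ∀ h {h′} → suc h′ ≡ h → h′ ∈ neighbours h
  from-down _ refl = here refl
  complete : ∀ h {h′} → + h′ ℤ.- + h ≡ + 1 ℤ.- + 0 ⊎ + h′ ℤ.- + h ≡ + 0 ℤ.- + 1 → h′ ∈ neighbours h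
  complete h {h′} (inj₁ eq) =
    from-up h (≡.trans (≡.sym (ℕ.+-identityʳ h′)) (+-diff⇒ h′ h 1 0 eq))
  complete h {h′} (inj₂ eq) =
    from-down h (≡.trans (ℕ.+-comm 1 h′) (+-diff⇒ h′ h 0 1 eq))

pair-unique : ∀ {x y : ℕ} → x ≢ y → Unique (x ∷ y ∷ [])
pair-unique x≢y = (x≢y All.∷ All.[]) AllPairs.∷ All.[] AllPairs.∷ AllPairs.[]

singleton-unique : ∀ {A : Set} (x : A) → Unique (x ∷ [])
singleton-unique x = All.[] AllPairs.∷ AllPairs.[]

neighbours-unique : ∀ h → Unique (neighbours h)
neighbours-unique zero    = singleton-unique 1
neighbours-unique (suc h) = pair-unique (λ ())

finiteSum-δ₁ : ∀ {V : ℕ → Set} {S : ℕ → ℕ → ℕ → Set} {w} → (∀ h → V h ⇔ h ≡ 1) → ∀ h →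
  FiniteSum (Walk S V h {0}) (walkWeight w (λ _ → 𝕂.1#) h) (δ₁ h)
finiteSum-δ₁ V⇔ zero          = finiteSum-∅ λ { [] V0 → contradiction (to (V⇔ 0) V0) λ () }
finiteSum-δ₁ V⇔ (suc zero)    = finiteSum-singleton [] (from (V⇔ 1) refl) λ { [] _ → refl }
finiteSum-δ₁ V⇔ (suc (suc h)) =
  finiteSum-∅ λ { [] Vh → contradiction (to (V⇔ (2 ℕ.+ h)) Vh) λ () }

atHeight1⇔ : ∀ (x : ℤ) h → ((x , h) ≡ (x , 1)) ⇔ h ≡ 1
atHeight1⇔ x h = mk⇔ (≡.cong proj₂) (≡.cong (x ,_))

-- R₃ paths.

module _ (L : ℕ) (κ : 𝕂.Carrier) (κ²≈1-cd : κ 𝕂.* κ 𝕂.≈ 𝕂.1# 𝕂.- c 𝕂.* d) where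
  open R₃-Sum κ κ²≈1-cd

  private
    module P = FamilyPaths (R₃ κ) L UpDown-unit (λ _ → R₃-stepWeight κ) (λ _ → 𝕂.1#)
                           (λ _ _ _ → refl) (λ _ → refl)

    w₃≡ : ∀ h h′ → R₃-stepWeight κ h h′ ≡ w₃ h h′
    w₃≡ 0                   0                   = refl
    w₃≡ 0                   1                   = refl
    w₃≡ 0                   (suc (suc _))       = refl
    w₃≡ 1                   0                   = refl
    w₃≡ 1                   1                   = refl
    w₃≡ 1                   2                   = refl
    w₃≡ 1                   (suc (suc (suc _))) = refl
    w₃≡ 2                   0                   = refl
    w₃≡ 2                   1                   = refl
    w₃≡ 2                   (suc (suc _))       = refl
    w₃≡ (suc (suc (suc _))) _                   = refl

  R₃-sum : FiniteSum (IsPath (R₃ κ) L) (weight (R₃ κ) L) (q L 0)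
  R₃-sum = finiteSum-resp (λ _ → id) (λ _ → id)
    (𝕂.trans (𝕂.*-identityˡ (walkSum neighbours (R₃-stepWeight κ) δ₁ (2 ℕ.* L) 1))
      (𝕂.trans (walkSum-cong neighbours δ₁ (λ h h′ → 𝕂.reflexive (w₃≡ h h′)) (2 ℕ.* L) 1)
        (≡.subst (λ n → σ₃ n 1 𝕂.≈ q L 0) (double≡2* L) (σ₃≈q L))))
    (P.finiteSum-pathFrom 1
      (finiteSum-walks neighbours-unique neighbours⇔UpDown (finiteSum-δ₁ (atHeight1⇔ _)) (2 ℕ.* L) 1))

-- R₄ paths as marked walks at positive heights.

PosStep : ℕ → ℕ → Set
PosStep h h′ = UpDownStep h h′ × 0 ℕ.< h′

posNeighbours⇔PosStep : ∀ {h h′} → h′ ∈ posNeighbours h ⇔ PosStep h h′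
posNeighbours⇔PosStep {h} {h′} = mk⇔
  (λ h′∈ → let h′∈N , 0<h′ = sound h h′∈ in to neighbours⇔UpDown h′∈N , 0<h′)
  (λ { (step , 0<h′) → complete h (from neighbours⇔UpDown step) 0<h′ })
  where
  sound : ∀ h {h′} → h′ ∈ posNeighbours h → h′ ∈ neighbours h × 0 ℕ.< h′
  sound zero          (here refl)         = here refl , s≤s z≤n
  sound (suc zero)    (here refl)         = there (here refl) , s≤s z≤n
  sound (suc (suc h)) (here refl)         = here refl , s≤s z≤n
  sound (suc (suc h)) (there (here refl)) = there (here refl) , s≤s z≤n
  complete : ∀ h {h′} → h′ ∈ neighbours h → 0 ℕ.< h′ → h′ ∈ posNeighbours h
  complete zero          h′∈                 0<h′ = h′∈
  complete (suc zero)    (here refl)         ()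
  complete (suc zero)    (there h′∈)         0<h′ = h′∈
  complete (suc (suc h)) h′∈                 0<h′ = h′∈

posNeighbours-unique : ∀ h → Unique (posNeighbours h)
posNeighbours-unique zero          = singleton-unique 1
posNeighbours-unique (suc zero)    = singleton-unique 2
posNeighbours-unique (suc (suc h)) = pair-unique (λ ())

walk-positive⇔ : ∀ {S : ℕ → ℕ → Set} {V} h {n} (hs : Vec ℕ n) →
  Walk (λ _ h h′ → S h h′ × 0 ℕ.< h′) V h hs ⇔ (Walk (λ _ → S) V h hs × ∀ j → 0 ℕ.< lookup hs j)
walk-positive⇔ h []        = mk⇔ (λ end → end , λ ()) proj₁
walk-positive⇔ h (h′ ∷ hs) = mk⇔
  (λ { ((step , 0<h′) , walk) → let walk′ , pos = to (walk-positive⇔ h′ hs) walk in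
         (step , walk′) , λ { fzero → 0<h′ ; (fsuc j) → pos j } })
  (λ { ((step , walk) , pos) →
         (step , pos fzero) , from (walk-positive⇔ h′ hs) (walk , pos ∘ fsuc) })

walkWeight-cong : ∀ {w w′ : ℕ → ℕ → ℕ → 𝕂.Carrier} {v} → (∀ i h h′ → w i h h′ 𝕂.≈ w′ i h h′) →
  ∀ h {n} (hs : Vec ℕ n) → walkWeight w v h hs 𝕂.≈ walkWeight w′ v h hs
walkWeight-cong {v = v} w≈w′ h []        = 𝕂.refl {v h}
walkWeight-cong {w} {w′} w≈w′ h (h′ ∷ hs) =
  𝕂.*-cong {w 0 h h′} {w′ 0 h h′} (w≈w′ 0 h h′) (walkWeight-cong (w≈w′ ∘ suc) h′ hs)

-- Steps are numbered from 0. The next three lemmas treat a mark at the start, a first step that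
-- precedes the mark, and the renumbering after that step is removed.
w₄ : ℕ → ℕ → ℕ → ℕ → 𝕂.Carrier
w₄ m i = R₄-stepWeight m (suc i)

w₄-zero : ∀ i h h′ → w₄ 0 i h h′ ≡ wβ h h′
w₄-zero i 0                   _                   = refl
w₄-zero i 1                   0                   = refl
w₄-zero i 1                   1                   = refl
w₄-zero i 1                   2                   = refl
w₄-zero i 1                   (suc (suc (suc _))) = refl
w₄-zero i 2                   0                   = refl
w₄-zero i 2                   1                   = refl
w₄-zero i 2                   (suc (suc _))       = refl
w₄-zero i (suc (suc (suc _))) _                   = refl

w₄-first : ∀ m h h′ → w₄ (suc m) 0 h h′ ≡ wα h h′
w₄-first m 0                   _                   = refl
w₄-first m 1                   0                   = refl
w₄-first m 1                   1                   = refl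
w₄-first m 1                   2                   = refl
w₄-first m 1                   (suc (suc (suc _))) = refl
w₄-first m 2                   0                   = refl
w₄-first m 2                   1                   = refl
w₄-first m 2                   (suc (suc _))       = refl
w₄-first m (suc (suc (suc _))) _                   = refl

w₄-suc : ∀ m i h h′ → w₄ (suc m) (suc i) h h′ ≡ w₄ m i h h′
w₄-suc m i 0                   _                   = refl
w₄-suc m i 1                   0                   = refl
w₄-suc m i 1                   1                   = refl
w₄-suc m i 1                   2                   = refl
w₄-suc m i 1                   (suc (suc (suc _))) = refl
w₄-suc m i 2                   0                   = refl
w₄-suc m i 2                   1                   = refl
w₄-suc m i 2                   (suc (suc _))       = refl
w₄-suc m i (suc (suc (suc _))) _                   = refl

module _ {V : ℕ → Set} (V⇔ : ∀ h → V h ⇔ h ≡ 1) where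

  Marked : ℕ → ∀ {n} → Vec ℕ n × Fin (suc n) → Set
  Marked h (hs , m) = Walk (λ _ → PosStep) V h hs × lookup (h ∷ hs) m ≡ 1

  markedWeight : ℕ → ∀ {n} → Vec ℕ n × Fin (suc n) → 𝕂.Carrier
  markedWeight h (hs , m) = walkWeight (w₄ (toℕ m)) (λ _ → 𝕂.1#) h hs

  private
    prepend : ℕ → ∀ {n} → Vec ℕ n × Fin (suc n) → Vec ℕ (suc n) × Fin (2 ℕ.+ n)
    prepend h (hs , m) = h ∷ hs , fsuc m

    prepend-injective : ∀ {h n} {x y : Vec ℕ n × Fin (suc n)} → prepend h x ≡ prepend h y → x ≡ y
    prepend-injective refl = refl

    -- The dichotomy behind `σ₄`: either the first vertex is marked, or the walk takes a step
    -- towards its mark.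
    MarkedHere MarkedLater : ℕ → ∀ {n} → Vec ℕ n × Fin (suc n) → Set
    MarkedHere h x = ∃[ hs ] x ≡ (hs , fzero) × Walk (λ _ → PosStep) V h hs × h ≡ 1
    MarkedLater h {zero}  x = ⊥
    MarkedLater h {suc n} x =
      ∃[ h′ ] h′ ∈ posNeighbours h × ∃[ y ] x ≡ prepend h′ y × Marked h′ {n} y

    finiteSum-here : ∀ n h → FiniteSum (MarkedHere h {n}) (markedWeight h) (markHere n h)
    finiteSum-here n zero          = finiteSum-∅ λ { _ (_ , _ , _ , ()) }
    finiteSum-here n (suc zero)    =
      finiteSum-resp
        (λ { _ (hs , x≡ , walk) → hs , x≡ , walk , refl })
        (λ { _ (hs , x≡ , walk , _) → hs , x≡ , walk })
        (𝕂.*-identityˡ (σβ n 1))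
        (finiteSum-image (_, fzero) 𝕂.1# (≡.cong proj₁)
          (λ hs → 𝕂.trans (walkWeight-cong (λ i h h′ → 𝕂.reflexive (w₄-zero i h h′)) 1 hs)
            (𝕂.sym (𝕂.*-identityˡ (walkWeight (λ _ → wβ) (λ _ → 𝕂.1#) 1 hs))))
          (finiteSum-walks posNeighbours-unique posNeighbours⇔PosStep (finiteSum-δ₁ V⇔) n 1))
    finiteSum-here n (suc (suc h)) = finiteSum-∅ λ { _ (_ , _ , _ , ()) }

  finiteSum-marked : ∀ n h → FiniteSum (Marked h {n}) (markedWeight h) (σ₄ n h)
  finiteSum-marked zero h =
    finiteSum-resp
      (λ { _ (hs , refl , walk , h≡1) → walk , h≡1 })
      (λ { (hs , fzero) (walk , h≡1) → hs , refl , walk , h≡1 })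
      (𝕂.refl {markHere 0 h})
      (finiteSum-here zero h)
  finiteSum-marked (suc n) h =
    finiteSum-resp
      (λ { _ (inj₁ (hs , refl , walk , h≡1)) → walk , h≡1
         ; _ (inj₂ (h′ , h′∈ , (hs , m) , refl , walk , mark)) →
             (to posNeighbours⇔PosStep h′∈ , walk) , mark })
      (λ { (hs , fzero) (walk , h≡1) → inj₁ (hs , refl , walk , h≡1)
         ; (h′ ∷ hs , fsuc m) ((step , walk) , mark) →
             inj₂ (h′ , from posNeighbours⇔PosStep step , (hs , m) , refl , walk , mark) })
      (𝕂.refl {σ₄ (suc n) h})
      (finiteSum-⊎
        (λ { _ (_ , refl , _) (_ , _ , _ , () , _) })
        (finiteSum-here (suc n) h)
        (finiteSum-⋃ (posNeighbours h) (posNeighbours-unique h)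
          (λ { (_ , refl , _) (_ , refl , _) → refl })
          (λ {h′} _ → finiteSum-image (prepend h′) (wα h h′) prepend-injective
            (λ { (hs , m) → 𝕂.*-cong {w₄ (suc (toℕ m)) 0 h h′} {wα h h′}
                   (𝕂.reflexive (w₄-first (toℕ m) h h′))
                   (walkWeight-cong (λ i a b → 𝕂.reflexive (w₄-suc (toℕ m) i a b)) h′ hs) })
            (finiteSum-marked n h′))))

module _ (L : ℕ) where
  private
    module P (m : ℕ) = FamilyPaths (R₄-marked m) L UpDown-unit (w₄ m) (λ _ → 𝕂.1#)
                                   (λ _ _ _ → refl) (λ _ → refl)

    height-place : ∀ {n} (hs : Vec ℕ n) j → height (lookup (place 0 1 hs) j) ≡ lookup (1 ∷ hs) j
    height-place hs j = ≡.cong proj₂ (place-lookup 0 1 hs j)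

  R₄-sum : FiniteSum (IsR₄Path L) (R₄-weight L) (q L 0)
  R₄-sum = finiteSum-resp
    (λ { _ ((hs , m) , refl , walk , mark) →
           let walk′ , pos = to (walk-positive⇔ 1 hs) walk in
           P.place-path (toℕ m) 1 hs walk′
           , (λ j → ≡.subst (0 ℕ.<_) (≡.sym (height-place hs j))
                      (case-pos pos j))
           , ≡.trans (height-place hs m) mark })
    (λ { (p , m) (path , pos , mark) → unplace p m path pos mark })
    (𝕂.trans (𝕂.*-identityˡ (σ₄ (2 ℕ.* L) 1))
      (≡.subst (λ n → σ₄ n 1 𝕂.≈ q L 0) (double≡2* L) (σ₄≈q L)))
    -- The weights vary with the mark, so heights and mark are carried over together; the common
    -- factor is the initial weight 1.
    (finiteSum-image (λ { (hs , m) → place 0 1 hs , m }) 𝕂.1#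
      (λ eq → ≡.cong₂ _,_ (place-injective 0 1 (≡.cong proj₁ eq)) (≡.cong proj₂ eq))
      (λ { (hs , m) → P.weight-place (toℕ m) 1 hs })
      (finiteSum-marked (atHeight1⇔ _) (2 ℕ.* L) 1))
    where
    case-pos : ∀ {n} {hs : Vec ℕ n} → (∀ j → 0 ℕ.< lookup hs j) → ∀ j → 0 ℕ.< lookup (1 ∷ hs) j
    case-pos pos fzero    = s≤s z≤n
    case-pos pos (fsuc j) = pos j
    unplace : ∀ p m → P.PathFrom (toℕ m) 1 p → (∀ j → 0 ℕ.< height (lookup p j)) →
      height (lookup p m) ≡ 1 →
      ∃[ y ] (p , m) ≡ (place 0 1 (proj₁ y) , proj₂ y) × Marked (atHeight1⇔ (+ (2 ℕ.* L))) 1 y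
    unplace p m path pos mark with hs , refl , walk ← P.path-place (toℕ m) 1 p path =
      (hs , m) , refl
      , from (walk-positive⇔ 1 hs)
          (walk , λ j → ≡.subst (0 ℕ.<_) (height-place hs (fsuc j)) (pos (fsuc j)))
      , ≡.trans (≡.sym (height-place hs m)) mark

-- R₁ paths in double steps.

∈-range : ∀ N k {j} → j ∈ range N k ⇔ (k ≤ j × j < N)
∈-range zero    k       = mk⇔ (λ ()) (λ { (_ , ()) })
∈-range (suc N) zero    = mk⇔
  (λ { (here refl) → z≤n , s≤s z≤n
     ; (there j∈)  → let j′ , j′∈ , j≡ = ∈-map⁻ suc j∈ in
         z≤n , ≡.subst (_< suc N) (≡.sym j≡) (s≤s (proj₂ (to (∈-range N 0) j′∈))) })
  (λ { (_ , s≤s {zero}  _)   → here refl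
     ; (_ , s≤s {suc j} j<N) → there (∈-map⁺ suc (from (∈-range N 0) (z≤n , j<N))) })
∈-range (suc N) (suc k) = mk⇔
  (λ j∈ → let j′ , j′∈ , j≡ = ∈-map⁻ suc j∈ ; k≤ , <N = to (∈-range N k) j′∈ in
     ≡.subst (suc k ≤_) (≡.sym j≡) (s≤s k≤) , ≡.subst (_< suc N) (≡.sym j≡) (s≤s <N))
  (λ { (s≤s k≤j , s≤s j<N) → ∈-map⁺ suc (from (∈-range N k) (k≤j , j<N)) })

range-unique : ∀ N k → Unique (range N k)
range-unique zero    k       = AllPairs.[]
range-unique (suc N) zero    =
  All.tabulate (λ j∈ 0≡j → let _ , _ , j≡ = ∈-map⁻ suc j∈ in
    contradiction (≡.trans 0≡j j≡) λ ())
  AllPairs.∷ map⁺ ℕ.suc-injective (range-unique N 0)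
range-unique (suc N) (suc k) = map⁺ ℕ.suc-injective (range-unique N k)

odd-injective : ∀ {j k} → odd j ≡ odd k → j ≡ k
odd-injective {j} {k} eq =
  ≡.trans (≡.sym (⌊odd/2⌋ j)) (≡.trans (≡.cong ⌊_/2⌋ eq) (⌊odd/2⌋ k))

pred≤⇒≤suc : ∀ k {j} → ℕ.pred k ≤ j → k ≤ suc j
pred≤⇒≤suc zero    _   = z≤n
pred≤⇒≤suc (suc k) k≤j = s≤s k≤j

odd-+ : ∀ k′ k → 2 ℕ.* k′ ℕ.+ odd k ≡ odd (k′ ℕ.+ k)
odd-+ zero     k = refl
odd-+ (suc k′) k = ≡.trans (≡.cong (ℕ._+ odd k) (ℕ.*-suc 2 k′)) (≡.cong (2 ℕ.+_) (odd-+ k′ k))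

R₁-Step-unit : ∀ p {δ} → R₁-Step p δ → proj₁ δ ≡ 1ℤ
R₁-Step-unit 0ℙ refl       = refl
R₁-Step-unit 1ℙ (_ , refl) = refl

S₁ : ℕ → ℕ → ℕ → Set
S₁ = heightStep (λ i → R₁-Step (parity (suc i)))

W₁ : ℕ → ℕ → ℕ → 𝕂.Carrier
W₁ i = R₁-stepWeight (parity (suc i))

parity-suc-odd : ∀ j → parity (suc (odd j)) ≡ 0ℙ
parity-suc-odd zero    = refl
parity-suc-odd (suc j) = parity-suc-odd j

W₁-odd : ∀ k j → W₁ 0 (odd k) (suc (odd j)) ≡ w₁ k
W₁-odd (suc k) j       = refl
W₁-odd zero    zero    = refl
W₁-odd zero    (suc j) rewrite parity-suc-odd j = refl

S₁-down⇒ : ∀ h′ h″ → S₁ 1 h′ h″ → h′ ≡ suc h″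
S₁-down⇒ h′ h″ step =
  ≡.sym (≡.trans (ℕ.+-comm 1 h″) (+-diff⇒ h″ h′ 0 1 (≡.cong proj₂ step)))

S₁-down : ∀ h → S₁ 1 (suc h) h
S₁-down h = ≡.cong (1ℤ ,_) (+-diff⇐ h (suc h) 0 1 (ℕ.+-comm h 1))

S₁-odd : ∀ k j → ℕ.pred k ≤ j → S₁ 0 (odd k) (suc (odd j))
-- The displacement from 2 k + 1 to 2 j + 2 is 2 i - 1 with i = j + 1 - k, and the truncated
-- subtraction is exact because k ≤ j + 1.
S₁-odd k j k-1≤j = i , ≡.cong (1ℤ ,_) (+-diff⇐ (suc (odd j)) (odd k) (2 ℕ.* i) 1 (begin
  suc (odd j) ℕ.+ 1        ≡⟨ ℕ.+-comm (suc (odd j)) 1 ⟩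
  odd (suc j)              ≡⟨ ≡.cong odd (ℕ.m∸n+n≡m (pred≤⇒≤suc k k-1≤j)) ⟨
  odd (i ℕ.+ k)            ≡⟨ odd-+ i k ⟨
  2 ℕ.* i ℕ.+ odd k        ∎))
  where
  open ≡.≡-Reasoning
  i = suc j ℕ.∸ k

-- The target is a successor because a step down to h follows; this excludes the step from height 1
-- to height 0.
S₁-odd⇒ : ∀ k h → S₁ 0 (odd k) (suc h) → ∃[ j ] ℕ.pred k ≤ j × h ≡ odd j
S₁-odd⇒ k h (k′ , eq) = shift (k′ ℕ.+ k) (ℕ.m≤n+m k k′) (begin
  2 ℕ.+ h                  ≡⟨ ℕ.+-comm 1 (suc h) ⟩
  suc h ℕ.+ 1              ≡⟨ +-diff⇒ (suc h) (odd k) (2 ℕ.* k′) 1 (≡.cong proj₂ eq) ⟩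
  2 ℕ.* k′ ℕ.+ odd k       ≡⟨ odd-+ k′ k ⟩
  odd (k′ ℕ.+ k)           ∎)
  where
  open ≡.≡-Reasoning
  shift : ∀ m → k ≤ m → 2 ℕ.+ h ≡ odd m → ∃[ j ] ℕ.pred k ≤ j × h ≡ odd j
  shift zero    _   ()
  shift (suc j) k≤m eq = j , ℕ.pred-mono-≤ k≤m , ℕ.suc-injective (ℕ.suc-injective eq)

module _ {V : ℕ → Set} (V⇔ : ∀ h → V h ⇔ h ≡ 1) where

  -- A double step lowers k by at most one, and k must end at 0. This makes both the starting
  -- heights and the upward jumps finite in number.
  R₁-bounded : ∀ n k (hs : Vec ℕ (double n)) → Walk S₁ V (odd k) hs → k ≤ n
  R₁-bounded zero    zero    []             end = z≤n
  R₁-bounded zero    (suc k) []             end = contradiction (to (V⇔ _) end) λ ()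
  R₁-bounded (suc n) k       (h′ ∷ h″ ∷ hs) (step , step′ , walk)
    with refl ← S₁-down⇒ h′ h″ step′
    with j , k-1≤j , refl ← S₁-odd⇒ k h″ step
    = pred≤⇒≤suc k (ℕ.≤-trans k-1≤j (R₁-bounded n j hs walk))

  -- Step sets and weights have period two in the step number, so a walk without its first double
  -- step is of the same kind. The jump goes to height 2 j + 2 with k - 1 ≤ j ≤ n, the range of
  -- summation in `ρ`.
  finiteSum-R₁ : ∀ n k →
    FiniteSum (Walk S₁ V (odd k) {double n}) (walkWeight W₁ (λ _ → 𝕂.1#) (odd k)) (ρ n k)
  finiteSum-R₁ zero    zero    = finiteSum-δ₁ V⇔ 1
  finiteSum-R₁ zero    (suc k) = finiteSum-δ₁ V⇔ (odd (suc k))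
  finiteSum-R₁ (suc n) k       =
    finiteSum-resp (λ _ → id) (λ _ → id) total
      (finiteSum-∷ is (suc ∘ odd) (range-unique (suc n) (ℕ.pred k))
        (odd-injective ∘ ℕ.suc-injective)
        (λ j∈ → S₁-odd k _ (proj₁ (to (∈-range (suc n) (ℕ.pred k)) j∈)))
        complete
        (λ {j} _ → finiteSum-∷ (j ∷ []) odd (singleton-unique j) odd-injective
          (λ { (here refl) → S₁-down (odd j) })
          (λ h″ hs step walk → j , here refl , ℕ.suc-injective (≡.sym (S₁-down⇒ (suc (odd j)) h″ step)))
          (λ {j} _ → finiteSum-R₁ n j)))
    where
    is = range (suc n) (ℕ.pred k)
    t : ℕ → 𝕂.Carrier
    t j = 𝕂.1# 𝕂.* ρ n j 𝕂.+ 𝕂.0#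
    complete : ∀ h′ (hs : Vec ℕ (suc (double n))) → S₁ 0 (odd k) h′ → Walk (S₁ ∘ suc) V h′ hs →
               ∃[ j ] j ∈ is × h′ ≡ suc (odd j)
    complete h′ (h″ ∷ hs) step (step′ , walk)
      -- The second step is read first: being a descent, it shows that `h′` is positive, as
      -- `S₁-odd⇒` requires.
      with refl ← S₁-down⇒ h′ h″ step′
      with j , k-1≤j , refl ← S₁-odd⇒ k h″ step
      = j , from (∈-range (suc n) (ℕ.pred k)) (k-1≤j , s≤s (R₁-bounded n j hs walk)) , refl
    total : (∑ is λ j → W₁ 0 (odd k) (suc (odd j)) 𝕂.* t j) 𝕂.≈ ρ (suc n) k
    total = 𝕂.trans
      (∑-cong is (λ j → 𝕂.*-cong {W₁ 0 (odd k) (suc (odd j))} {w₁ k} {t j} {ρ n j}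
        (𝕂.reflexive (W₁-odd k j))
        (𝕂.trans (𝕂.+-identityʳ (𝕂.1# 𝕂.* ρ n j)) (𝕂.*-identityˡ (ρ n j)))))
      (𝕂.trans (∑-*ˡ (w₁ k) is (ρ n))
        (𝕂.*-congˡ {w₁ k} (∑-range (suc n) (ℕ.pred k) (ρ n))))


odd-start⇔ : ∀ {u : Vertex} k → u ≡ (0ℤ , 2 ℕ.* k ℕ.+ 1) ⇔ u ≡ (0ℤ , odd k)
odd-start⇔ k = mk⇔ (λ start → ≡.trans start (≡.cong (0ℤ ,_) (≡.sym (odd≡2*+1 k))))
                   (λ start → ≡.trans start (≡.cong (0ℤ ,_) (odd≡2*+1 k)))

R₁-sum : ∀ L → FiniteSum (IsPath R₁ L) (weight R₁ L) (tailSum (suc L) (λ k → α ^ᴷ k 𝕂.* ρ L k) 0)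
R₁-sum L = finiteSum-resp
  (λ { p (k , _ , start , end , steps) →
         (k , from (odd-start⇔ k) start) , end , steps })
  (λ { p ((k , start) , end , steps) →
         let path = to (odd-start⇔ k) start , end , steps in
         k , from (∈-range (suc L) 0) (z≤n , s≤s (bounded k p path)) , path })
  (𝕂.trans
    (∑-cong is (λ k → 𝕂.*-congʳ {ρ L k} (𝕂.reflexive (≡.cong (α ^ᴷ_) (⌊odd/2⌋ k)))))
    (∑-range (suc L) 0 (λ k → α ^ᴷ k 𝕂.* ρ L k)))
  (finiteSum-⋃ is (range-unique (suc L) 0)
    (λ { (start , _) (start′ , _) →
           odd-injective (≡.cong proj₂ (≡.trans (≡.sym start) start′)) })
    (λ {k} _ → P.finiteSum-pathFrom (odd k)
      (≡.subst (λ n → FiniteSum (Walk S₁ V (odd k) {n}) (walkWeight W₁ (λ _ → 𝕂.1#) (odd k)) (ρ L k))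
        (double≡2* L) (finiteSum-R₁ (atHeight1⇔ (+ (2 ℕ.* L))) L k))))
  where
  module P = FamilyPaths R₁ L (λ {i} → R₁-Step-unit (parity i)) W₁ (λ _ → 𝕂.1#)
                         (λ _ _ _ → refl) (λ _ → refl)
  is = range (suc L) 0
  V : ℕ → Set
  V h = (+ (2 ℕ.* L) , h) ≡ (+ (2 ℕ.* L) , 1)
  bounded : ∀ k p → P.PathFrom (odd k) p → k ≤ L
  bounded k p path = let hs , _ , walk = P.path-place (odd k) p path in
    ≡.subst (λ n → (hs : Vec ℕ n) → Walk S₁ V (odd k) hs → k ≤ L) (double≡2* L)
      (R₁-bounded (atHeight1⇔ (+ (2 ℕ.* L))) L k) hs walk

-- Coefficients of multiples of powers of c.

module _ {a ℓ} (R : CommutativeRing a ℓ) where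
  open CommutativeRing R renaming (refl to ≈-refl) hiding (zero)
  open PowerSeries R
  private
    module S = CommutativeRing commutativeRing
  open RawSemiring (Semiring.rawSemiring S.semiring) using (_^_)

  X-*-zero : ∀ f → (X *ₛ f) 0 ≈ 0#
  X-*-zero f = trans (+-identityʳ _) (zeroˡ (f 0))

  X-*-suc : ∀ f n → (X *ₛ f) (suc n) ≈ f n
  X-*-suc f n = begin
    0# * f (suc n) + (shift X *ₛ f) n   ≈⟨ +-cong (zeroˡ _) (*-congₛ {g = f} {g′ = f} shiftX (λ _ → ≈-refl) n) ⟩
    0# + (const 1# *ₛ f) n              ≈⟨ +-identityˡ _ ⟩
    (const 1# *ₛ f) n                   ≈⟨ *-identityˡₛ f n ⟩
    f n                                 ∎
    where
    open import Relation.Binary.Reasoning.Setoid setoid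
    shiftX : shift X ≈ₛ const 1#
    shiftX zero    = ≈-refl
    shiftX (suc n) = ≈-refl

  X^-*-low : ∀ M f n → n < M → ((X ^ M) *ₛ f) n ≈ 0#
  X^-*-low (suc M) f zero    _         = trans (*-assocₛ X (X ^ M) f 0) (X-*-zero ((X ^ M) *ₛ f))
  X^-*-low (suc M) f (suc n) (s≤s n<M) =
    trans (*-assocₛ X (X ^ M) f (suc n)) (trans (X-*-suc ((X ^ M) *ₛ f) n) (X^-*-low M f n n<M))

-- The empty sum needs four cases because the zero series reduces only once both indices are
-- constructors.
coeff-∑ : ∀ {A : Set} i j (xs : List A) w →
          foldr ℚ._+_ 0ℚ (map (λ x → coeff i j (w x)) xs) ≡ coeff i j (∑ xs w)
coeff-∑ zero    zero    [] w = refl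
coeff-∑ zero    (suc j) [] w = refl
coeff-∑ (suc i) zero    [] w = refl
coeff-∑ (suc i) (suc j) [] w = refl
coeff-∑ i j (x ∷ xs) w = ≡.cong (coeff i j (w x) ℚ.+_) (coeff-∑ i j xs w)

coeff-c^-*-low : ∀ M z {i} j → i < M → coeff i j ((c ^ᴷ M) 𝕂.* z) ≡ 0ℚ
coeff-c^-*-low M z {i} j i<M =
  ≡.trans (X^-*-low ℚ[[d]].commutativeRing M z i i<M j) (ℚ[[d]].const-0 j)

double-or-odd : ∀ h → (∃[ k ] h ≡ double k) ⊎ (∃[ k ] h ≡ odd k)
double-or-odd zero          = inj₁ (0 , refl)
double-or-odd (suc zero)    = inj₂ (0 , refl)
double-or-odd (suc (suc h)) with double-or-odd h
... | inj₁ (k , eq) = inj₁ (suc k , ≡.cong (2 ℕ.+_) eq)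
... | inj₂ (k , eq) = inj₂ (suc k , ≡.cong (2 ℕ.+_) eq)

double≢odd : ∀ j k → double j ≢ odd k
double≢odd (suc j) (suc k) eq = double≢odd j k (ℕ.suc-injective (ℕ.suc-injective eq))
double≢odd zero    zero    ()
double≢odd (suc j) zero    ()

-- R₂ paths, coefficient by coefficient.

module _ (L : ℕ) (κ : 𝕂.Carrier) (κ²≈1-cd : κ 𝕂.* κ 𝕂.≈ 𝕂.1# 𝕂.- c 𝕂.* d) where
  open R₂-Sum κ κ²≈1-cd

  private
    v : ℕ → 𝕂.Carrier
    v h = κ 𝕂.* (d ^ᴷ ⌊ h /2⌋)

    atEnd : ℕ → Vertex
    atEnd h = + (2 ℕ.* L) , h

    V : ℕ → Set
    V h = ∃[ k ] atEnd h ≡ atEnd (2 ℕ.* k ℕ.+ 1)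

    module P = FamilyPaths (R₂ κ) L UpDown-unit (λ _ _ _ → 𝕂.1#) v
                           (λ _ _ _ → refl) (λ _ → refl)

    finiteSum-v₂ : ∀ h → (∃[ k ] h ≡ double k) ⊎ (∃[ k ] h ≡ odd k) →
      FiniteSum (Walk (λ _ → UpDownStep) V h {0}) (walkWeight (λ _ _ _ → 𝕂.1#) v h) (v₂ h)
    finiteSum-v₂ _ (inj₁ (k , refl)) = finiteSum-resp (λ _ → id) (λ _ → id)
      (𝕂.sym {v₂ (double k)} {𝕂.0#} (v₂-double k))
      (finiteSum-∅ λ { [] (k′ , eq) →
         double≢odd k k′ (≡.trans (≡.cong proj₂ eq) (≡.sym (odd≡2*+1 k′))) })
    finiteSum-v₂ _ (inj₂ (k , refl)) = finiteSum-resp (λ _ → id) (λ _ → id) v≈v₂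
      (finiteSum-singleton [] (k , ≡.cong atEnd (odd≡2*+1 k)) λ { [] _ → refl })
      where
      v≈v₂ : v (odd k) 𝕂.≈ v₂ (odd k)
      v≈v₂ = 𝕂.trans {v (odd k)} {κ 𝕂.* (d ^ᴷ k)} {v₂ (odd k)}
        (𝕂.reflexive (≡.cong (λ m → κ 𝕂.* (d ^ᴷ m)) (⌊odd/2⌋ k)))
        (𝕂.sym {v₂ (odd k)} {κ 𝕂.* (d ^ᴷ k)} (v₂-odd k))

    -- These paths start at height at most 2 i + 1. They are finitely many, and only they can
    -- contribute to a coefficient of cⁱ dʲ.
    Start≤ : ℕ → Path L → Set
    Start≤ i p = ∃[ k ] k ∈ range (suc i) 0 × P.PathFrom (odd k) p

    pathSum walkSum₂ : ℕ → 𝕂.Carrier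
    pathSum  k = κ 𝕂.* c ^ᴷ ⌊ odd k /2⌋ 𝕂.* σ₂ (2 ℕ.* L) (odd k)
    walkSum₂ k = κ 𝕂.* c ^ᴷ k 𝕂.* σ₂ (double L) (odd k)

    pathSum≡walkSum₂ : ∀ k → pathSum k ≡ walkSum₂ k
    pathSum≡walkSum₂ k = ≡.cong₂ (λ m n → κ 𝕂.* c ^ᴷ m 𝕂.* σ₂ n (odd k))
                           (⌊odd/2⌋ k) (≡.sym (double≡2* L))

    finiteSum-Start≤ : ∀ i → FiniteSum (Start≤ i) (weight (R₂ κ) L) (tailSum (suc i) walkSum₂ 0)
    finiteSum-Start≤ i = finiteSum-resp (λ _ → id) (λ _ → id)
      (𝕂.trans {∑ is pathSum} {∑ is walkSum₂} {tailSum (suc i) walkSum₂ 0}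
        (∑-cong is {pathSum} {walkSum₂} (λ k → 𝕂.reflexive (pathSum≡walkSum₂ k)))
        (∑-range (suc i) 0 walkSum₂))
      (finiteSum-⋃ {s = pathSum} is (range-unique (suc i) 0)
        (λ { (start , _) (start′ , _) →
               odd-injective (≡.cong proj₂ (≡.trans (≡.sym start) start′)) })
        (λ {k} _ → P.finiteSum-pathFrom (odd k)
          (finiteSum-walks neighbours-unique neighbours⇔UpDown
            (λ h → finiteSum-v₂ h (double-or-odd h)) (2 ℕ.* L) (odd k))))
      where is = range (suc i) 0

    -- The initial weight supplies the power of c; the cofactor is the other κ-factor of that vertex
    -- times the weight of the walk.
    factor-c^ : ∀ k p → P.PathFrom (odd k) p →
                ∃[ z ] weight (R₂ κ) L p 𝕂.≈ (c ^ᴷ k) 𝕂.* z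
    factor-c^ k p path =
      let hs , p≡ , _ = P.path-place (odd k) p path
          u = walkWeight (λ _ _ _ → 𝕂.1#) v (odd k) hs
      in κ 𝕂.* u
         , 𝕂.trans {weight (R₂ κ) L p} {weight (R₂ κ) L (place 0 (odd k) hs)} {(c ^ᴷ k) 𝕂.* (κ 𝕂.* u)}
             (𝕂.reflexive (≡.cong (weight (R₂ κ) L) p≡))
           (𝕂.trans {weight (R₂ κ) L (place 0 (odd k) hs)} {κ 𝕂.* c ^ᴷ ⌊ odd k /2⌋ 𝕂.* u}
              {(c ^ᴷ k) 𝕂.* (κ 𝕂.* u)}
             (P.weight-place (odd k) hs)
           (𝕂.trans {κ 𝕂.* c ^ᴷ ⌊ odd k /2⌋ 𝕂.* u} {κ 𝕂.* c ^ᴷ k 𝕂.* u} {(c ^ᴷ k) 𝕂.* (κ 𝕂.* u)}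
             (𝕂.reflexive (≡.cong (λ m → κ 𝕂.* c ^ᴷ m 𝕂.* u) (⌊odd/2⌋ k)))
             (xy∙z≈y∙xz κ (c ^ᴷ k) u)))
      where
      open CommutativeSemigroupProperties 𝕂.*-commutativeSemigroup using (xy∙z≈y∙xz)

    Start≤⇒path : ∀ i p → Start≤ i p → IsPath (R₂ κ) L p
    Start≤⇒path i p (k , _ , start , end , steps) = (k , from (odd-start⇔ k) start) , end , steps

    vanish : ∀ i j p → IsPath (R₂ κ) L p → ¬ Start≤ i p → coeff i j (weight (R₂ κ) L p) ≡ 0ℚ
    vanish i j p ((k , start) , end , steps) ¬start≤ = case (k ℕ.≤? i)
      where
      path : P.PathFrom (odd k) p
      path = to (odd-start⇔ k) start , end , steps
      case : Dec (k ≤ i) → coeff i j (weight (R₂ κ) L p) ≡ 0ℚ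
      case (yes k≤i) = contradiction (k , from (∈-range (suc i) 0) (z≤n , s≤s k≤i) , path) ¬start≤
      case (no  k≰i) = let z , w≈ = factor-c^ k p path in
        ≡.trans (w≈ i j) (coeff-c^-*-low k z j (ℕ.≰⇒> k≰i))

    -- With the cutoff M = i the error is a multiple of c^(i+1), invisible in the coefficient of cⁱ.
    coeff-walkSum₂ : ∀ i j → coeff i j (tailSum (suc i) walkSum₂ 0) ≡ coeff i j (q L 0)
    coeff-walkSum₂ i j = let z , Σ≈ = Σσ₂≡q i L in begin
      coeff i j (tailSum (suc i) walkSum₂ 0)
        ≡⟨ Σ≈ i j ⟩
      coeff i j (q L 0) ℚ.+ coeff i j ((c ^ᴷ suc i) 𝕂.* z)
        ≡⟨ ≡.cong (coeff i j (q L 0) ℚ.+_) (coeff-c^-*-low (suc i) z j ℕ.≤-refl) ⟩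
      coeff i j (q L 0) ℚ.+ 0ℚ
        ≡⟨ ℚ.+-identityʳ (coeff i j (q L 0)) ⟩
      coeff i j (q L 0) ∎
      where open ≡.≡-Reasoning

  R₂-sum : ∀ {s} → q L 0 𝕂.≈ s → FormalSum (IsPath (R₂ κ) L) (weight (R₂ κ) L) s
  R₂-sum {s} q≈s i j = let xs , xs! , xs⇔ , sum = finiteSum-Start≤ i in
    xs , xs!
    , (λ p → Start≤⇒path i p ∘ to (xs⇔ p))
    , (λ p path p∉xs → vanish i j p path (p∉xs ∘ from (xs⇔ p)))
    , ≡.trans (coeff-∑ i j xs (weight (R₂ κ) L))
      (≡.trans (sum i j) (≡.trans (coeff-walkSum₂ i j) (q≈s i j)))

theorem3 : (L : ℕ) → 1 ≤ L →
    (κ : 𝕂.Carrier) → IsKappa κ →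
    (Φ : DEHPFunctional) →
    FiniteSum (IsPath R₁ L) (weight R₁ L) (normalisation Φ L)
    × FormalSum (IsPath (R₂ κ) L) (weight (R₂ κ) L) (normalisation Φ L)
    × FiniteSum (IsPath (R₃ κ) L) (weight (R₃ κ) L) (normalisation Φ L)
    × FiniteSum (IsR₄Path L) (R₄-weight L) (normalisation Φ L)
theorem3 L _ κ isKappa Φ =
  -- The R₁ sum meets φ directly through `f≈Σρ`; the other three sums pass through `q`.
  finiteSum-resp (λ _ → id) (λ _ → id) (𝕂.trans (𝕂.sym (f≈Σρ L)) (f≈normalisation L)) (R₁-sum L)
  , R₂-sum L κ square q≈Z
  , finiteSum-resp (λ _ → id) (λ _ → id) q≈Z (R₃-sum L κ square)
  , finiteSum-resp (λ _ → id) (λ _ → id) q≈Z (R₄-sum L)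
  where
  open IsKappa isKappa using (square)
  open DEHP Φ
  q≈Z : q L 0 𝕂.≈ normalisation Φ L
  q≈Z = 𝕂.trans (𝕂.sym (f≈q L)) (f≈normalisation L)
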